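{- Let $n\ge 1$ and let $S$ be either the Motzkin monoid $\mathscr M_n$ or the Jones monoid $\mathscr J_n$. For $\delta\in D(S)$ let $F_\delta=\{\alpha\in E(S):\widehat{\alpha}=\delta\}$. Then $E(S)$ is the disjoint union of the sets $F_\delta$ as $\delta$ ranges over $D(S)$, and consequently $$|E(S)|=\sum_{\delta\in D(S)} f_\delta,\qquad f_\delta=\prod_{\theta}\bigl(1+u_\theta l_\theta\bigr),$$ where the product is over the cycle components $\theta$ of the interface graph $\Gamma(\delta)$ (as explained in the context, only cycles containing both an upper and a lower return edge contribute a factor different from $1$).
   Context: Upper vertices $[n]=\{1,\dots,n\}$, lower vertices $[n]'=\{1',\dots,n'\}$. The partition monoid $\mathscr P_n$ consists of set partitions of $[n]\cup[n]'$; to multiply $\alpha,\beta$, identify each lower vertex $i'$ of $\alpha$ with the upper vertex $i$ of $\beta$ (a middle row), take connected components of the union of the blocks, and let $\alpha\beta$ be the induced partition on the upper vertices of $\alpha$ and lower vertices of $\beta$ (components lying entirely in the middle row are discarded). A partition is planar if, placing $i$ at $(i,1)$ and $i'$ at $(i,0)$, its blocks can be drawn as pairwise disjoint connected sets in the rectangle $[1,n]\times[0,1]$. $\mathscr M_n$ is the monoid of planar partitions with all blocks of size $1$ or $2$; $\mathscr J_n\subseteq\mathscr M_n$ consists of planar partitions with all blocks of size exactly $2$. A block is transversal if it meets both $[n]$ and $[n]'$; the rank of $\alpha$ is its number of transversal blocks. $E(S)$ is the set of idempotents of $S$. $D(S)$ is the set of all elements of $S$ of rank $0$ together with all idempotents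 of $S$ of rank $1$. Hat map: for $\alpha\in E(\mathscr M_n)$ of rank $r$ with transversal blocks $\{j_1,i_1'\},\dots,\{j_r,i_r'\}$, $j_1<\dots<j_r$ (then $i_1<\dots<i_r$ by planarity), let $s=2\lfloor r/2\rfloor$ and let $\widehat\alpha$ be obtained from $\alpha$ by replacing, for $t=1,\dots,s/2$, the blocks $\{j_{2t-1},i'_{2t-1}\},\{j_{2t},i'_{2t}\}$ by $\{j_{2t-1},j_{2t}\}$ and $\{i'_{2t-1},i'_{2t}\}$ (so $\widehat\alpha=\alpha$ if $r\le1$). Interface graph: for $\alpha\in\mathscr M_n$, $\Gamma(\alpha)$ is the graph on vertex set $[n]$ with an upper edge $\{a,b\}$ for each block $\{a,b\}\subseteq[n]$ of $\alpha$ and a lower edge $\{a,b\}$ for each block $\{a',b'\}\subseteq[n]'$ of $\alpha$ (upper and lower edges are distinguished, so an upper and a lower edge on the same pair form a cycle of length 2). Its connected components are cycles or paths. Returns: an upper block $\{a,b\}$ ($a<b$) of $\alpha$ is a return if there is no upper block $\{c,d\}$ with $c<a<b<d$ and no upper vertex $x<a$ lies in a transversal block; a lower block $\{a',b'\}$ ($a<b$) is a return if there is no lower block $\{c',d'\}$ with $c<a<b<d$ and no lower vertex $x'$ with $x<a$ lies in a transversal block. The corresponding edges of $\Gamma(\alpha)$ are called upper/lower return edges. For a cycle $\theta$ of $\Gamma(\alpha)$, $u_\theta$ and $l_\theta$ are the numbers of upper and lower return edges in $\theta$. (The paper takes the product over the cycles lying to the left of the leftmost transversal; cycles containing no return edges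 contribute factor $1$, so this is the same product.) -}

module Defs where

open import Data.Nat using (ℕ; zero; suc; _+_; _*_; _∸_; _<_; _<ᵇ_)
open import Data.Bool using (Bool; true; false; _∧_; _∨_; not; if_then_else_)
open import Data.Fin using (Fin; toℕ) renaming (_≟_ to _≟ᶠ_)
open import Data.Maybe using (Maybe; just; nothing; is-just)
open import Data.Sum using (_⊎_; inj₁; inj₂)
open import Data.Product using (_×_; _,_; ∃)
open import Data.List using (List; []; _∷_; length; mapMaybe; allFin; map)
open import Data.Bool.ListAction using (any; all)
open import Data.Nat.ListAction using (product)
open import Data.Vec using (Vec; lookup; tabulate)
open import Relation.Nullary using (¬_)
open import Relation.Nullary.Decidable using (isYes)
open import Relation.Binary.PropositionalEquality using (_≡_)
open import Relation.Binary.Construct.Closure.ReflexiveTransitive using (Star)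
open import Function.Bundles using (_⇔_)

-- Vertices: inj₁ i is the upper vertex i, inj₂ i is the lower vertex i'
-- (vertex indices 0..n-1 stand for 1..n).

V : ℕ → Set
V n = Fin n ⊎ Fin n

-- A diagram with blocks of size ≤ 2, recorded by its partner function:
-- up[i] / low[i] is the partner of i / i' (nothing = singleton block).
record Diag (n : ℕ) : Set where
  constructor mkDiag
  field
    up  : Vec (Maybe (V n)) n
    low : Vec (Maybe (V n)) n
open Diag public

partner : ∀ {n} → Diag n → V n → Maybe (V n)
partner d (inj₁ i) = lookup (up d) i
partner d (inj₂ i) = lookup (low d) i

IsMatching : ∀ {n} → Diag n → Set
IsMatching {n} d = ∀ (x y : V n) → partner d x ≡ just y → (partner d y ≡ just x) × ¬ (x ≡ y)

-- planarity: positions on the boundary of the rectangle in cyclic order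
-- 1,2,…,n,n',…,2',1'; blocks of size ≤ 2 can be drawn disjointly iff no two
-- 2-element blocks cross in this cyclic order.
pos : ∀ {n} → V n → ℕ
pos {n} (inj₁ i) = toℕ i
pos {n} (inj₂ i) = (n + n) ∸ toℕ i

Planar : ∀ {n} → Diag n → Set
Planar {n} d = ∀ (a b c e : V n) → partner d a ≡ just b → partner d c ≡ just e →
  ¬ ((pos a < pos c) × (pos c < pos b) × (pos b < pos e))

Total : ∀ {n} → Diag n → Set
Total {n} d = ∀ (x : V n) → ∃ λ y → partner d x ≡ just y

data Kind : Set where
  Motzkin Jones : Kind

InS : ∀ {n} → Kind → Diag n → Set
InS Motzkin d = IsMatching d × Planar d
InS Jones   d = IsMatching d × Planar d × Total d

-- Product in the partition monoid, characterised relationally: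
-- γ = αβ iff two outer vertices lie in the same block of γ exactly when they
-- are connected in the union of α (top/middle rows) and β (middle/bottom rows).

data Row3 (n : ℕ) : Set where
  top mid bot : Fin n → Row3 n

ια : ∀ {n} → V n → Row3 n
ια (inj₁ i) = top i
ια (inj₂ i) = mid i

ιβ : ∀ {n} → V n → Row3 n
ιβ (inj₁ i) = mid i
ιβ (inj₂ i) = bot i

ιout : ∀ {n} → V n → Row3 n
ιout (inj₁ i) = top i
ιout (inj₂ i) = bot i

data Step {n} (α β : Diag n) : Row3 n → Row3 n → Set where
  viaα : ∀ x y → partner α x ≡ just y → Step α β (ια x) (ια y)
  viaβ : ∀ x y → partner β x ≡ just y → Step α β (ιβ x) (ιβ y)

Edge : ∀ {n} → Diag n → Diag n → Row3 n → Row3 n → Set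
Edge α β a b = Step α β a b ⊎ Step α β b a

Conn : ∀ {n} → Diag n → Diag n → Row3 n → Row3 n → Set
Conn α β = Star (Edge α β)

SameBlock : ∀ {n} → Diag n → V n → V n → Set
SameBlock γ x y = (x ≡ y) ⊎ (partner γ x ≡ just y)

IsProduct : ∀ {n} → Diag n → Diag n → Diag n → Set
IsProduct {n} α β γ = ∀ (x y : V n) → SameBlock γ x y ⇔ Conn α β (ιout x) (ιout y)

InE : ∀ {n} → Kind → Diag n → Set
InE S α = InS S α × IsProduct α α α

transv : ∀ {n} → Diag n → Fin n → Maybe (Fin n × Fin n)
transv d j with lookup (up d) j
... | just (inj₂ i) = just (j , i)
... | _ = nothing

transversals : ∀ {n} → Diag n → List (Fin n × Fin n)
transversals {n} d = mapMaybe (transv d) (allFin n)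

rank : ∀ {n} → Diag n → ℕ
rank d = length (transversals d)

InD : ∀ {n} → Kind → Diag n → Set
InD S d = (InS S d × rank d ≡ 0) ⊎ (InE S d × rank d ≡ 1)

pairUp : ∀ {A : Set} → List A → List (A × A)
pairUp (x ∷ y ∷ r) = (x , y) ∷ pairUp r
pairUp _ = []

_==_ : ∀ {n} → Fin n → Fin n → Bool
i == j = isYes (i ≟ᶠ j)

hatUp : ∀ {n} → List ((Fin n × Fin n) × (Fin n × Fin n)) → Fin n → Maybe (V n) → Maybe (V n)
hatUp [] j old = old
hatUp (((j₁ , i₁) , (j₂ , i₂)) ∷ ps) j old =
  if j == j₁ then just (inj₁ j₂) else (if j == j₂ then just (inj₁ j₁) else hatUp ps j old)

hatLow : ∀ {n} → List ((Fin n × Fin n) × (Fin n × Fin n)) → Fin n → Maybe (V n) → Maybe (V n)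
hatLow [] i old = old
hatLow (((j₁ , i₁) , (j₂ , i₂)) ∷ ps) i old =
  if i == i₁ then just (inj₂ i₂) else (if i == i₂ then just (inj₂ i₁) else hatLow ps i old)

hat : ∀ {n} → Diag n → Diag n
hat d = mkDiag (tabulate (λ j → hatUp ps j (lookup (up d) j)))
               (tabulate (λ i → hatLow ps i (lookup (low d) i)))
  where ps = pairUp (transversals d)

upNb : ∀ {n} → Diag n → Fin n → Maybe (Fin n)
upNb d u with lookup (up d) u
... | just (inj₁ w) = just w
... | _ = nothing

lowNb : ∀ {n} → Diag n → Fin n → Maybe (Fin n)
lowNb d u with lookup (low d) u
... | just (inj₂ w) = just w
... | _ = nothing

_=?_ : ∀ {n} → Maybe (Fin n) → Fin n → Bool
just a =? w = a == w
nothing =? w = false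

adj : ∀ {n} → Diag n → Fin n → Fin n → Bool
adj d u w = (upNb d u =? w) ∨ (lowNb d u =? w)

iter : ∀ {A : Set} → ℕ → (A → A) → A → A
iter zero f a = a
iter (suc k) f a = f (iter k f a)

expand : ∀ {n} → Diag n → (Fin n → Bool) → (Fin n → Bool)
expand {n} d C w = C w ∨ any (λ u → C u ∧ adj d u w) (allFin n)

comp : ∀ {n} → Diag n → Fin n → (Fin n → Bool)
comp {n} d v = iter n (expand d) (λ w → v == w)

-- a component is a cycle iff each of its vertices has an upper and a lower edge
isCycle : ∀ {n} → Diag n → (Fin n → Bool) → Bool
isCycle {n} d C = all (λ u → not (C u) ∨ (is-just (upNb d u) ∧ is-just (lowNb d u))) (allFin n)

-- v is the least vertex of its component (components are indexed by these)
isRep : ∀ {n} → Diag n → Fin n → Bool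
isRep {n} d v = all (λ u → not (comp d v u) ∨ not (toℕ u <ᵇ toℕ v)) (allFin n)

_<ᶠ_ : ∀ {n} → Fin n → Fin n → Bool
a <ᶠ b = toℕ a <ᵇ toℕ b

transUp : ∀ {n} → Diag n → Fin n → Bool
transUp d x with lookup (up d) x
... | just (inj₂ _) = true
... | _ = false

transLow : ∀ {n} → Diag n → Fin n → Bool
transLow d x with lookup (low d) x
... | just (inj₁ _) = true
... | _ = false

-- upper block {a,b} (a<b) is a return
upRet : ∀ {n} → Diag n → Fin n → Fin n → Bool
upRet {n} d a b =
  not (any (λ c → nest c) (allFin n)) ∧ not (any (λ x → (x <ᶠ a) ∧ transUp d x) (allFin n))
  where
  nest : Fin n → Bool
  nest c with upNb d c
  ... | just e = (c <ᶠ a) ∧ (b <ᶠ e)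
  ... | nothing = false

-- lower block {a',b'} (a<b) is a return
lowRet : ∀ {n} → Diag n → Fin n → Fin n → Bool
lowRet {n} d a b =
  not (any (λ c → nest c) (allFin n)) ∧ not (any (λ x → (x <ᶠ a) ∧ transLow d x) (allFin n))
  where
  nest : Fin n → Bool
  nest c with lowNb d c
  ... | just e = (c <ᶠ a) ∧ (b <ᶠ e)
  ... | nothing = false

countB : ∀ {n} → (Fin n → Bool) → ℕ
countB {n} p = length (mapMaybe (λ a → if p a then just a else nothing) (allFin n))

uCount : ∀ {n} → Diag n → (Fin n → Bool) → ℕ
uCount d C = countB (λ a → C a ∧ ok a)
  where
  ok : _ → Bool
  ok a with upNb d a
  ... | just b = (a <ᶠ b) ∧ upRet d a b
  ... | nothing = false

lCount : ∀ {n} → Diag n → (Fin n → Bool) → ℕ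
lCount d C = countB (λ a → C a ∧ ok a)
  where
  ok : _ → Bool
  ok a with lowNb d a
  ... | just b = (a <ᶠ b) ∧ lowRet d a b
  ... | nothing = false

f : ∀ {n} → Diag n → ℕ
f {n} d = product (map factor (allFin n))
  where
  factor : Fin n → ℕ
  factor v = if isRep d v ∧ isCycle d (comp d v)
             then 1 + uCount d (comp d v) * lCount d (comp d v)
             else 1

{-# OPTIONS --safe #-}
module Submission where

-- A planar α is idempotent iff every transversal {j , i′} of it has j and i in the same component of
-- Γ(α), which is then a path with ends j and i, a "strand". Hatting closes two consecutive strands
-- up to a cycle of Γ(hat α) by adding an upper and a lower return arc, so α is recovered from hat α
-- by cutting, in some of its cycles, one upper and one lower return arc. Conversely, any such cuts
-- give an idempotent: each cut cycle falls apart into two strands, and strands are ordered at the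
-- bottom as at the top, since the parity of the number of vertices of one strand to the left of v is
-- the same for all v on another strand. Thus the left ends of the cut arcs are joined to each
-- other, as are the right ones, and the new transversals cross nothing.

open import Defs
open import Algebra.Bundles using (CommutativeRing)
open import Data.Bool using (Bool; true; false; _∧_; _∨_; not; if_then_else_; _xor_)
open import Data.Bool.ListAction using (any; all)
open import Data.Bool.Properties using (T-≡; ¬-not; ∨-zeroʳ; ∧-identityʳ; xor-∧-commutativeRing)
open import Data.Empty using (⊥; ⊥-elim)
open import Data.Fin as Fin using (Fin; toℕ; _<_) renaming (_≟_ to _≟ᶠ_)
import Data.Fin.Properties as Finₚ
open import Data.List using (List; []; _∷_; allFin; cartesianProduct; cartesianProductWith; concatMap; length; map; mapMaybe; tabulate)
open import Data.List.Membership.Propositional using (_∈_; find; lose)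
open import Data.List.Membership.Propositional.Properties using (∈-allFin; ∈-cartesianProduct⁺; ∈-cartesianProduct⁻; ∈-cartesianProductWith⁺; ∈-cartesianProductWith⁻; ∈-concatMap⁺; ∈-concatMap⁻; ∈-map⁺; ∈-map⁻)
open import Data.List.Membership.Propositional.Properties.WithK using (unique∧set⇒bag)
open import Data.List.Properties using (length-++; length-map; map-cong; map-tabulate; mapMaybe-cong; tabulate-cong)
open import Data.List.Relation.Binary.BagAndSetEquality using (∼bag⇒↭)
open import Data.List.Relation.Binary.Permutation.Propositional.Properties using (↭-length)
open import Data.List.Relation.Unary.All as All using (All; []; _∷_)
open import Data.List.Relation.Unary.AllPairs using (AllPairs; []; _∷_)
open import Data.List.Relation.Unary.AllPairs.Properties using (tabulate⁺-<)
open import Data.List.Relation.Unary.Any using (here; there)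
open import Data.List.Relation.Unary.Unique.Propositional using (Unique)
import Data.List.Relation.Unary.Unique.Propositional.Properties as Unique
open import Data.Maybe using (Maybe; just; nothing; fromMaybe; is-just; maybe)
open import Data.Maybe.Properties using (just-injective)
open import Data.Nat as ℕ using (ℕ; zero; suc; z≤n; s≤s; _≤_)
open import Data.Nat.ListAction using (sum; product)
import Data.Nat.Properties as ℕₚ
open import Data.Product using (Σ; ∃; _×_; _,_; proj₁; proj₂)
open import Data.Sum using (_⊎_; inj₁; inj₂; swap)
open import Data.Sum.Properties using (inj₁-injective)
open import Data.Vec as Vec using (Vec; []; _∷_; lookup)
import Data.Vec.Properties as Vecₚ
open import Data.Vec.Properties using (lookup∘tabulate)
open import Function using (_∘_)
open import Function.Bundles using (_⇔_; mk⇔; Equivalence)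
open import Relation.Binary using (tri<; tri≈; tri>)
open import Relation.Binary.Construct.Closure.ReflexiveTransitive using (Star; ε; _◅_; _◅◅_; gmap; reverse)
open import Relation.Binary.PropositionalEquality using (_≡_; _≢_; refl; sym; trans; cong; cong₂; subst; subst₂)
open import Relation.Nullary using (¬_; yes; no)

open import Algebra.Properties.CommutativeSemigroup (CommutativeRing.+-commutativeSemigroup xor-∧-commutativeRing) using (interchange)

-- Boolean predicates on finite sets

-- What a drawing shows at a glance is here found by counting modulo 2. Cutting an upper and a lower
-- arc of a cycle visibly leaves two paths, but where each of them ends has to be proved. One fact
-- does this twice: a finite set matched up by the arcs of one side is even. It settles the
-- connectivity of a cut cycle as well as the position of one strand relative to another. The
-- restriction to return arcs has two purposes. The ends of such an arc are covered by no arc, so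
-- transversals can be attached there; and the arc lies left of the transversal of δ, if there is
-- one. Hence the pairing of consecutive transversals made by `hat` finds exactly the cut arcs again
-- and leaves over the transversal of δ. In the factor `1 + u l` of a cycle, the 1 stands for
-- leaving it alone and `u l` for the choices of one upper and one lower return arc.

==-refl : ∀ {n} (i : Fin n) → (i == i) ≡ true
==-refl i with i ≟ᶠ i
... | yes _ = refl
... | no i≢i = ⊥-elim (i≢i refl)

==⇒≡ : ∀ {n} {i j : Fin n} → (i == j) ≡ true → i ≡ j
==⇒≡ {i = i} {j} eq with i ≟ᶠ j
... | yes i≡j = i≡j

≢⇒== : ∀ {n} {i j : Fin n} → i ≢ j → (i == j) ≡ false
≢⇒== {i = i} {j} i≢j with i ≟ᶠ j
... | yes i≡j = ⊥-elim (i≢j i≡j)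
... | no _ = refl

<ᶠ⇒< : ∀ {n} {i j : Fin n} → (i <ᶠ j) ≡ true → i < j
<ᶠ⇒< {i = i} eq = ℕₚ.<ᵇ⇒< (toℕ i) _ (Equivalence.from T-≡ eq)

<⇒<ᶠ : ∀ {n} {i j : Fin n} → i < j → (i <ᶠ j) ≡ true
<⇒<ᶠ i<j = Equivalence.to T-≡ (ℕₚ.<⇒<ᵇ i<j)

true≢false : ∀ {b} → b ≡ true → b ≡ false → ⊥
true≢false refl ()

≢true⇒≡false : ∀ {b} → ¬ b ≡ true → b ≡ false
≢true⇒≡false = ¬-not

≮⇒<ᶠ : ∀ {n} {i j : Fin n} → ¬ i < j → (i <ᶠ j) ≡ false
≮⇒<ᶠ i≮j = ≢true⇒≡false (i≮j ∘ <ᶠ⇒<)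

not-true : ∀ {b} → not b ≡ true → b ≡ false
not-true {false} _ = refl

false⇒not : ∀ {b} → b ≡ false → not b ≡ true
false⇒not refl = refl

∧-true : ∀ {a b} → a ∧ b ≡ true → a ≡ true × b ≡ true
∧-true {true} {true} _ = refl , refl

true-∧ : ∀ {a b} → a ≡ true → b ≡ true → a ∧ b ≡ true
true-∧ refl refl = refl

∖-false : ∀ {a b} → a ≡ true → a ∧ not b ≡ false → b ≡ true
∖-false {true} {true} _ _ = refl

∨-true : ∀ {a b} → a ∨ b ≡ true → a ≡ true ⊎ b ≡ true
∨-true {true} _ = inj₁ refl
∨-true {false} eq = inj₂ eq

∨-trueˡ : ∀ {a b} → a ≡ true → a ∨ b ≡ true
∨-trueˡ refl = refl

∨-trueʳ : ∀ {a b} → b ≡ true → a ∨ b ≡ true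
∨-trueʳ {a} refl = ∨-zeroʳ a

module _ {A : Set} (p : A → Bool) where

  any-true : ∀ xs → any p xs ≡ true → ∃ λ x → p x ≡ true
  any-true (x ∷ xs) eq with ∨-true {p x} eq
  ... | inj₁ px = x , px
  ... | inj₂ eq′ = any-true xs eq′

  true-any : ∀ {x xs} → x ∈ xs → p x ≡ true → any p xs ≡ true
  true-any (here refl) px = ∨-trueˡ px
  true-any (there x∈xs) px = ∨-trueʳ {p _} (true-any x∈xs px)

  all-true : ∀ {x xs} → all p xs ≡ true → x ∈ xs → p x ≡ true
  all-true eq (here refl) = proj₁ (∧-true eq)
  all-true eq (there x∈xs) = all-true (proj₂ (∧-true {p _} eq)) x∈xs

  true-all : ∀ xs → (∀ x → p x ≡ true) → all p xs ≡ true
  true-all [] h = refl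
  true-all (x ∷ xs) h = true-∧ (h x) (true-all xs h)

module _ {n : ℕ} (p : Fin n → Bool) where

  any-allFin : any p (allFin n) ≡ true → ∃ λ x → p x ≡ true
  any-allFin = any-true p (allFin n)

  allFin-any : ∀ x → p x ≡ true → any p (allFin n) ≡ true
  allFin-any x = true-any p (∈-allFin x)

  all-allFin : all p (allFin n) ≡ true → ∀ x → p x ≡ true
  all-allFin eq x = all-true p eq (∈-allFin x)

  allFin-all : (∀ x → p x ≡ true) → all p (allFin n) ≡ true
  allFin-all = true-all p (allFin n)

least : ∀ {n} (C : Fin n → Bool) →
  (∃ λ x → C x ≡ true × (∀ y → C y ≡ true → ¬ y < x)) ⊎ (∀ x → C x ≡ false)
least {zero} C = inj₂ λ ()
least {suc n} C with C Fin.zero in eq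
... | true = inj₁ (Fin.zero , eq , λ _ _ ())
... | false with least (C ∘ Fin.suc)
...   | inj₁ (x , Cx , x-min) = inj₁ (Fin.suc x , Cx , λ
          { Fin.zero C0 _ → true≢false C0 eq
          ; (Fin.suc y) Cy (s≤s y<x) → x-min y Cy y<x })
...   | inj₂ none = inj₂ λ { Fin.zero → eq ; (Fin.suc x) → none x }

-- Sizes and parities of finite sets

size : ∀ {n} → (Fin n → Bool) → ℕ
size {zero} C = 0
size {suc n} C = (if C Fin.zero then 1 else 0) ℕ.+ size (C ∘ Fin.suc)

indicator-≤ : ∀ {a b} → (a ≡ true → b ≡ true) → (if a then 1 else 0) ℕ.≤ (if b then 1 else 0)
indicator-≤ {false} _ = z≤n
indicator-≤ {true} {true} _ = s≤s z≤n
indicator-≤ {true} {false} h with () ← h refl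

size-mono : ∀ {n} {C D : Fin n → Bool} → (∀ x → C x ≡ true → D x ≡ true) → size C ℕ.≤ size D
size-mono {zero} h = z≤n
size-mono {suc n} h = ℕₚ.+-mono-≤ (indicator-≤ (h Fin.zero)) (size-mono (h ∘ Fin.suc))

size-mono-< : ∀ {n} {C D : Fin n → Bool} → (∀ x → C x ≡ true → D x ≡ true) →
  ∀ x → C x ≡ false → D x ≡ true → size C ℕ.< size D
size-mono-< h Fin.zero eqC eqD rewrite eqC | eqD = s≤s (size-mono (h ∘ Fin.suc))
size-mono-< h (Fin.suc x) eqC eqD =
  ℕₚ.+-mono-≤-< (indicator-≤ (h Fin.zero)) (size-mono-< (h ∘ Fin.suc) x eqC eqD)

size≤n : ∀ {n} (C : Fin n → Bool) → size C ℕ.≤ n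
size≤n {zero} C = z≤n
size≤n {suc n} C with C Fin.zero
... | true = s≤s (size≤n (C ∘ Fin.suc))
... | false = ℕₚ.m≤n⇒m≤1+n (size≤n (C ∘ Fin.suc))

parity : ∀ {n} → (Fin n → Bool) → Bool
parity {zero} C = false
parity {suc n} C = C Fin.zero xor parity (C ∘ Fin.suc)

parity-cong : ∀ {n} {C D : Fin n → Bool} → (∀ x → C x ≡ D x) → parity C ≡ parity D
parity-cong {zero} h = refl
parity-cong {suc n} h = cong₂ _xor_ (h Fin.zero) (parity-cong (h ∘ Fin.suc))

parity-xor : ∀ {n} (C D : Fin n → Bool) → parity (λ x → C x xor D x) ≡ parity C xor parity D
parity-xor {zero} C D = refl
parity-xor {suc n} C D = trans (cong ((C Fin.zero xor D Fin.zero) xor_) (parity-xor (C ∘ Fin.suc) (D ∘ Fin.suc)))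
  (interchange (C Fin.zero) (D Fin.zero) (parity (C ∘ Fin.suc)) (parity (D ∘ Fin.suc)))

parity-∅ : ∀ {n} {C : Fin n → Bool} → (∀ x → C x ≡ false) → parity C ≡ false
parity-∅ {zero} h = refl
parity-∅ {suc n} h rewrite h Fin.zero = parity-∅ (h ∘ Fin.suc)

_∖_ : ∀ {n} → (Fin n → Bool) → Fin n → Fin n → Bool
(C ∖ x) y = C y ∧ not (y == x)

∖-∈ : ∀ {n} {C : Fin n → Bool} {x y} → C y ≡ true → y ≢ x → (C ∖ x) y ≡ true
∖-∈ Cy y≢x = true-∧ Cy (false⇒not (≢⇒== y≢x))

∈-∖ : ∀ {n} {C : Fin n → Bool} {x y} → (C ∖ x) y ≡ true → C y ≡ true × y ≢ x
∈-∖ {C = C} {x} {y} eq with ∧-true {C y} eq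
... | Cy , y≠x = Cy , λ { refl → true≢false (==-refl y) (not-true y≠x) }

parity-∖ : ∀ {n} {C : Fin n → Bool} x → C x ≡ true → parity C ≡ not (parity (C ∖ x))
parity-∖ {suc n} {C} Fin.zero Cx rewrite Cx =
  cong not (parity-cong (λ y → sym (∧-identityʳ (C (Fin.suc y)))))
parity-∖ {suc n} {C} (Fin.suc x) Cx =
  trans (cong (C Fin.zero xor_) (trans (parity-∖ {C = C ∘ Fin.suc} x Cx) (cong not (parity-cong suc-==))))
        (flip-head (C Fin.zero) _)
  where
  suc-== : ∀ y → C (Fin.suc y) ∧ not (y == x) ≡ C (Fin.suc y) ∧ not (Fin.suc y == Fin.suc x)
  suc-== y with y ≟ᶠ x
  ... | yes _ = refl
  ... | no _ = refl
  flip-head : ∀ a b → a xor not b ≡ not ((a ∧ true) xor b)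
  flip-head false b = refl
  flip-head true b = refl

module _ {n : ℕ} {M : Fin n → Fin n → Set} (M-sym : ∀ {x y} → M x y → M y x)
  (M-irr : ∀ {x} → ¬ M x x) (M-fun : ∀ {x y z} → M x y → M x z → y ≡ z) where

  -- Removing a vertex together with its partner flips the parity twice and leaves a matched set,
  -- since `M` is symmetric and functional. The fuel `k` bounds `size C`, which drops with each
  -- removal.
  parity-matched-fuel : ∀ k (C : Fin n → Bool) → size C ℕ.≤ k →
    (∀ x → C x ≡ true → ∃ λ y → M x y × C y ≡ true) → parity C ≡ false
  parity-matched-fuel k C bound matched with least C
  ... | inj₂ none = parity-∅ none
  ... | inj₁ (x , Cx , _) with matched x Cx
  ...   | y , Mxy , Cy = trans (parity-∖ x Cx) (trans (cong not (parity-∖ {C = C ∖ x} y y∈)) (removed k bound))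
    where
    y≢x : y ≢ x
    y≢x refl = M-irr Mxy
    y∈ : (C ∖ x) y ≡ true
    y∈ = ∖-∈ {C = C} Cy y≢x
    D : Fin n → Bool
    D = (C ∖ x) ∖ y
    D⊆C : ∀ z → D z ≡ true → C z ≡ true
    D⊆C z Dz = proj₁ (∈-∖ {C = C} (proj₁ (∈-∖ {C = C ∖ x} Dz)))
    x∉D : D x ≡ false
    x∉D = ≢true⇒≡false λ Dx → proj₂ (∈-∖ {C = C} {x} (proj₁ (∈-∖ {C = C ∖ x} Dx))) refl
    matched′ : ∀ z → D z ≡ true → ∃ λ w → M z w × D w ≡ true
    matched′ z Dz with ∈-∖ {C = C ∖ x} Dz
    ... | z∈ , z≢y with ∈-∖ {C = C} z∈
    ... | Cz , z≢x with matched z Cz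
    ... | w , Mzw , Cw = w , Mzw , ∖-∈ {C = C ∖ x}
          (∖-∈ {C = C} Cw λ { refl → z≢y (M-fun (M-sym Mzw) Mxy) })
          λ { refl → z≢x (M-fun (M-sym Mzw) (M-sym Mxy)) }
    removed : ∀ k → size C ℕ.≤ k → not (not (parity D)) ≡ false
    removed zero le with () ← ℕₚ.<-≤-trans (size-mono-< D⊆C x x∉D Cx) le
    removed (suc k) le rewrite parity-matched-fuel k D
      (ℕ.s≤s⁻¹ (ℕₚ.<-≤-trans (size-mono-< D⊆C x x∉D Cx) le)) matched′ = refl

  parity-matched : ∀ (C : Fin n → Bool) →
    (∀ x → C x ≡ true → ∃ λ y → M x y × C y ≡ true) → parity C ≡ false
  parity-matched C = parity-matched-fuel (size C) C ℕₚ.≤-refl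

-- Arcs, transversals and the interface graph

data Side : Set where
  upper lower : Side

opp : Side → Side
opp upper = lower
opp lower = upper

opp-opp : ∀ s → opp (opp s) ≡ s
opp-opp upper = refl
opp-opp lower = refl

s≢opp : ∀ s → s ≢ opp s
s≢opp upper ()
s≢opp lower ()

module _ {n : ℕ} where

  vtx vtxᵒ : Side → Fin n → V n
  vtx upper = inj₁
  vtx lower = inj₂
  vtxᵒ upper = inj₂
  vtxᵒ lower = inj₁

  vtx-injective : ∀ s {a b} → vtx s a ≡ vtx s b → a ≡ b
  vtx-injective upper refl = refl
  vtx-injective lower refl = refl

  vtxᵒ-injective : ∀ s {a b} → vtxᵒ s a ≡ vtxᵒ s b → a ≡ b
  vtxᵒ-injective upper refl = refl
  vtxᵒ-injective lower refl = refl

  vtx≢vtxᵒ : ∀ s {a b} → vtx s a ≢ vtxᵒ s b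
  vtx≢vtxᵒ upper ()
  vtx≢vtxᵒ lower ()

  Arc Tr : Diag n → Side → Fin n → Fin n → Set
  Arc α s a b = partner α (vtx s a) ≡ just (vtx s b)
  Tr α s a b = partner α (vtx s a) ≡ just (vtxᵒ s b)

  NoArc : Diag n → Side → Fin n → Set
  NoArc α s a = ∀ {b} → ¬ Arc α s a b

  data Block (α : Diag n) (s : Side) (a : Fin n) : Set where
    single : partner α (vtx s a) ≡ nothing → Block α s a
    arc : ∀ b → Arc α s a b → Block α s a
    tr : ∀ b → Tr α s a b → Block α s a

  block : ∀ α s a → Block α s a
  block α upper a with lookup (up α) a in eq
  ... | nothing = single eq
  ... | just (inj₁ b) = arc b eq
  ... | just (inj₂ b) = tr b eq
  block α lower a with lookup (low α) a in eq
  ... | nothing = single eq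
  ... | just (inj₁ b) = tr b eq
  ... | just (inj₂ b) = arc b eq

  arc-fun : ∀ {α} s {a b c} → Arc α s a b → Arc α s a c → b ≡ c
  arc-fun s p q = vtx-injective s (just-injective (trans (sym p) q))

  tr-fun : ∀ {α} s {a b c} → Tr α s a b → Tr α s a c → b ≡ c
  tr-fun s p q = vtxᵒ-injective s (just-injective (trans (sym p) q))

  tr⇒noArc : ∀ {α} s {a b} → Tr α s a b → NoArc α s a
  tr⇒noArc s p q = vtx≢vtxᵒ s (just-injective (trans (sym q) p))

  arc? : ∀ α s a → (∃ λ b → Arc α s a b) ⊎ NoArc α s a
  arc? α s a with block α s a
  ... | single eq = inj₂ λ p → case-nothing (trans (sym eq) p)
    where
    case-nothing : ∀ {x : V n} → nothing ≡ just x → ⊥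
    case-nothing ()
  ... | arc b p = inj₁ (b , p)
  ... | tr b p = inj₂ (tr⇒noArc s p)

  nb : Diag n → Side → Fin n → Maybe (Fin n)
  nb α upper = upNb α
  nb α lower = lowNb α

  nb⇒arc : ∀ α s {a b} → nb α s a ≡ just b → Arc α s a b
  nb⇒arc α upper {a} eq with lookup (up α) a
  nb⇒arc α upper {a} refl | just (inj₁ b) = refl
  nb⇒arc α lower {a} eq with lookup (low α) a
  nb⇒arc α lower {a} refl | just (inj₂ b) = refl

  arc⇒nb : ∀ α s {a b} → Arc α s a b → nb α s a ≡ just b
  arc⇒nb α upper {a} eq with lookup (up α) a
  arc⇒nb α upper {a} refl | just (inj₁ b) = refl
  arc⇒nb α lower {a} eq with lookup (low α) a
  arc⇒nb α lower {a} refl | just (inj₂ b) = refl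

  Adj Linked : Diag n → Fin n → Fin n → Set
  Adj α a b = ∃ λ s → Arc α s a b
  Linked α = Star (Adj α)

  =?-sound : ∀ {m : Maybe (Fin n)} {w} → (m =? w) ≡ true → m ≡ just w
  =?-sound {just a} eq = cong just (==⇒≡ eq)

  =?-complete : ∀ {m : Maybe (Fin n)} {w} → m ≡ just w → (m =? w) ≡ true
  =?-complete {w = w} refl = ==-refl w

  adj⇒Adj : ∀ α {a b} → adj α a b ≡ true → Adj α a b
  adj⇒Adj α {a} {b} eq with ∨-true {upNb α a =? b} eq
  ... | inj₁ h = upper , nb⇒arc α upper (=?-sound h)
  ... | inj₂ h = lower , nb⇒arc α lower (=?-sound h)

  Adj⇒adj : ∀ α {a b} → Adj α a b → adj α a b ≡ true
  Adj⇒adj α (upper , p) = ∨-trueˡ (=?-complete (arc⇒nb α upper p))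
  Adj⇒adj α {a} {b} (lower , p) = ∨-trueʳ {upNb α a =? b} (=?-complete (arc⇒nb α lower p))

  -- Connected components as computed by `comp`

  module _ (α : Diag n) where

    Closed : (Fin n → Bool) → Set
    Closed C = ∀ {a b} → C a ≡ true → Adj α a b → C b ≡ true

    closed-linked : ∀ {C a b} → Closed C → C a ≡ true → Linked α a b → C b ≡ true
    closed-linked cl Ca ε = Ca
    closed-linked cl Ca (e ◅ es) = closed-linked cl (cl Ca e) es

    expand-sound : ∀ C {w} → expand α C w ≡ true → C w ≡ true ⊎ ∃ λ u → C u ≡ true × Adj α u w
    expand-sound C {w} eq with ∨-true {C w} eq
    ... | inj₁ Cw = inj₁ Cw
    ... | inj₂ h with any-allFin (λ u → C u ∧ adj α u w) h
    ...   | u , h′ with ∧-true {C u} h′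
    ...     | Cu , e = inj₂ (u , Cu , adj⇒Adj α e)

    expand-⊇ : ∀ C {w} → C w ≡ true → expand α C w ≡ true
    expand-⊇ C = ∨-trueˡ

    expand-adj : ∀ C {u w} → C u ≡ true → Adj α u w → expand α C w ≡ true
    expand-adj C {u} {w} Cu e = ∨-trueʳ {C w}
      (allFin-any (λ u → C u ∧ adj α u w) u (true-∧ Cu (Adj⇒adj α e)))

    module _ (v : Fin n) where

      stage : ℕ → Fin n → Bool
      stage k = iter k (expand α) (v ==_)

      stage-sound : ∀ k {w} → stage k w ≡ true → Linked α v w
      stage-sound zero eq with refl ← ==⇒≡ eq = ε
      stage-sound (suc k) eq with expand-sound (stage k) eq
      ... | inj₁ h = stage-sound k h
      ... | inj₂ (u , h , e) = stage-sound k h ◅◅ e ◅ ε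

      stage-start : ∀ k → stage k v ≡ true
      stage-start zero = ==-refl v
      stage-start (suc k) = expand-⊇ (stage k) (stage-start k)

      -- Each round adds a vertex unless the set is already closed, and it then stays closed. So the
      -- `n` rounds made by `comp` exhaust the component.
      stage-grows : ∀ k → Closed (stage k) ⊎ k ℕ.< size (stage k)
      stage-grows zero = inj₂ (ℕₚ.≤-<-trans z≤n (size-mono-< {C = λ _ → false} (λ _ ()) v refl (==-refl v)))
      stage-grows (suc k) with least (λ w → stage (suc k) w ∧ not (stage k w))
      ... | inj₁ (w , h , _) = grown (stage-grows k)
        where
        new : stage (suc k) w ≡ true × stage k w ≡ false
        new = let p , q = ∧-true {stage (suc k) w} h in p , not-true q
        grown : Closed (stage k) ⊎ k ℕ.< size (stage k) → Closed (stage (suc k)) ⊎ suc k ℕ.< size (stage (suc k))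
        grown (inj₁ cl) with expand-sound (stage k) (proj₁ new)
        ... | inj₁ old = ⊥-elim (true≢false old (proj₂ new))
        ... | inj₂ (u , Cu , e) = ⊥-elim (true≢false (cl Cu e) (proj₂ new))
        grown (inj₂ lt) = inj₂ (ℕₚ.≤-<-trans lt
          (size-mono-< (λ _ → expand-⊇ (stage k)) w (proj₂ new) (proj₁ new)))
      ... | inj₂ none = inj₁ λ Ca e → expand-⊇ (stage k) (back (expand-adj (stage k) (back Ca) e))
        where
        back : ∀ {w} → stage (suc k) w ≡ true → stage k w ≡ true
        back {w} eq = ∖-false eq (none w)

      comp-closed : Closed (comp α v)
      comp-closed with stage-grows n
      ... | inj₁ cl = cl
      ... | inj₂ lt = ⊥-elim (ℕₚ.<⇒≱ lt (size≤n (stage n)))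

      comp-sound : ∀ {w} → comp α v w ≡ true → Linked α v w
      comp-sound = stage-sound n

      comp-complete : ∀ {w} → Linked α v w → comp α v w ≡ true
      comp-complete = closed-linked comp-closed (stage-start n)

-- Planarity in terms of arcs and transversals

module _ {n : ℕ} (α : Diag n) where

  -- Planarity without the mutual order of the transversals. After cutting, these conditions can be
  -- checked arc by arc, whereas the order has to be deduced from them by way of `strands-ordered`.
  -- The parameter `s` lets one argument serve both rows.
  record Noncrossing : Set where
    field
      arc-sym : ∀ s {a b} → Arc α s a b → Arc α s b a
      arc-irr : ∀ s {a} → ¬ Arc α s a a
      tr-sym : ∀ s {a b} → Tr α s a b → Tr α (opp s) b a
      no-cross : ∀ s {a b c d} → Arc α s a b → Arc α s c d → a < c → c < b → b < d → ⊥
      no-cover : ∀ s {a b x y} → Arc α s a b → Tr α s x y → a < x → x < b → ⊥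

    linked-sym : ∀ {a b} → Linked α a b → Linked α b a
    linked-sym = reverse λ { (s , p) → s , arc-sym s p }

  OrderedTr : Set
  OrderedTr = ∀ {j i j′ i′} → Tr α upper j i → Tr α upper j′ i′ → j < j′ → i < i′

  pos-lower : ∀ {i i′ : Fin n} → i < i′ → pos (inj₂ i′) ℕ.< pos (inj₂ i)
  pos-lower {i} {i′} i<i′ = ℕₚ.∸-monoʳ-< i<i′ (ℕₚ.≤-trans (ℕₚ.<⇒≤ (Finₚ.toℕ<n i′)) (ℕₚ.m≤m+n n n))

  pos-lower⁻ : ∀ {i i′ : Fin n} → pos (inj₂ i′) ℕ.< pos (inj₂ i) → i < i′
  pos-lower⁻ {i} {i′} lt with Finₚ.<-cmp i i′
  ... | tri< i<i′ _ _ = i<i′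
  ... | tri≈ _ refl _ = ⊥-elim (ℕₚ.<-irrefl refl lt)
  ... | tri> _ _ i′<i = ⊥-elim (ℕₚ.<-asym lt (pos-lower i′<i))

  pos-upper-lower : ∀ (j i : Fin n) → pos (inj₁ j) ℕ.< pos (inj₂ i)
  pos-upper-lower j i = ℕₚ.<-≤-trans (Finₚ.toℕ<n j)
    (ℕₚ.≤-trans (ℕₚ.≤-reflexive (sym (ℕₚ.m+n∸n≡m n n))) (ℕₚ.∸-monoʳ-≤ (n ℕ.+ n) (ℕₚ.<⇒≤ (Finₚ.toℕ<n i))))

  pos-lower-upper : ∀ (i j : Fin n) → ¬ pos (inj₂ i) ℕ.< pos (inj₁ j)
  pos-lower-upper i j lt = ℕₚ.<-asym lt (pos-upper-lower j i)

  planar⇒noncrossing : IsMatching α → Planar α → Noncrossing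
  planar⇒noncrossing mat pl = record
    { arc-sym = λ s p → proj₁ (mat _ _ p)
    ; arc-irr = λ s p → proj₂ (mat _ _ p) refl
    ; tr-sym = λ { upper p → proj₁ (mat _ _ p) ; lower p → proj₁ (mat _ _ p) }
    ; no-cross = λ
        { upper {a} {b} {c} {d} p q ac cb bd → pl (inj₁ a) (inj₁ b) (inj₁ c) (inj₁ d) p q (ac , cb , bd)
        -- `pos` runs through the lower row from right to left, so both arcs are read backwards and
        -- change places.
        ; lower {a} {b} {c} {d} p q ac cb bd → pl (inj₂ d) (inj₂ c) (inj₂ b) (inj₂ a)
            (proj₁ (mat (inj₂ c) (inj₂ d) q)) (proj₁ (mat (inj₂ a) (inj₂ b) p))
            (pos-lower bd , pos-lower cb , pos-lower ac) }
    ; no-cover = λ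
        { upper {a} {b} {x} {y} p q ax xb → pl (inj₁ a) (inj₁ b) (inj₁ x) (inj₂ y) p q
            (ax , xb , pos-upper-lower b y)
        ; lower {a} {b} {x} {y} p q ax xb → pl (inj₁ y) (inj₂ x) (inj₂ b) (inj₂ a)
            (proj₁ (mat (inj₂ x) (inj₁ y) q)) (proj₁ (mat (inj₂ a) (inj₂ b) p))
            (pos-upper-lower y b , pos-lower xb , pos-lower ax) }
    }

  planar⇒orderedTr : IsMatching α → Planar α → OrderedTr
  planar⇒orderedTr mat pl {j} {i} {j′} {i′} p q j<j′ with Finₚ.<-cmp i i′
  ... | tri< i<i′ _ _ = i<i′
  ... | tri≈ _ refl _ = ⊥-elim (Finₚ.<-irrefl
          (inj₁-injective (just-injective (trans (sym (proj₁ (mat (inj₁ j) (inj₂ i) p))) (proj₁ (mat (inj₁ j′) (inj₂ i) q))))) j<j′)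
  ... | tri> _ _ i′<i = ⊥-elim (pl (inj₁ j) (inj₂ i) (inj₁ j′) (inj₂ i′) p q
          (j<j′ , pos-upper-lower j′ i , pos-lower i′<i))

  module _ (nc : Noncrossing) where
    open Noncrossing nc

    noncrossing⇒matching : IsMatching α
    noncrossing⇒matching (inj₁ a) (inj₁ b) p = arc-sym upper p , λ { refl → arc-irr upper p }
    noncrossing⇒matching (inj₁ a) (inj₂ b) p = tr-sym upper p , λ ()
    noncrossing⇒matching (inj₂ a) (inj₁ b) p = tr-sym lower p , λ ()
    noncrossing⇒matching (inj₂ a) (inj₂ b) p = arc-sym lower p , λ { refl → arc-irr lower p }

    noncrossing⇒planar : OrderedTr → Planar α
    noncrossing⇒planar ord (inj₁ a) (inj₁ b) (inj₁ c) (inj₁ e) p q (ac , cb , be) = no-cross upper p q ac cb be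
    noncrossing⇒planar ord (inj₁ a) (inj₁ b) (inj₁ c) (inj₂ e) p q (ac , cb , be) = no-cover upper p q ac cb
    noncrossing⇒planar ord (inj₁ a) (inj₂ b) (inj₁ c) (inj₂ e) p q (ac , cb , be) =
      Finₚ.<-asym (ord p q ac) (pos-lower⁻ be)
    noncrossing⇒planar ord (inj₁ a) (inj₂ b) (inj₂ c) (inj₂ e) p q (ac , cb , be) =
      no-cover lower (arc-sym lower q) (tr-sym upper p) (pos-lower⁻ be) (pos-lower⁻ cb)
    noncrossing⇒planar ord (inj₂ a) (inj₂ b) (inj₂ c) (inj₂ e) p q (ac , cb , be) =
      no-cross lower (arc-sym lower q) (arc-sym lower p) (pos-lower⁻ be) (pos-lower⁻ cb) (pos-lower⁻ ac)
    noncrossing⇒planar ord (inj₂ a) b (inj₁ c) e p q (ac , cb , be) = pos-lower-upper a c ac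
    noncrossing⇒planar ord a (inj₁ b) (inj₂ c) e p q (ac , cb , be) = pos-lower-upper c b cb
    noncrossing⇒planar ord a (inj₂ b) c (inj₁ e) p q (ac , cb , be) = pos-lower-upper b e be

-- Strands

xor-false : ∀ {a b} → a xor b ≡ false → a ≡ b
xor-false {false} eq = sym eq
xor-false {true} {true} eq = refl

xor-true : ∀ {a b} → a xor b ≡ true → (a ≡ true × b ≡ false) ⊎ (a ≡ false × b ≡ true)
xor-true {false} eq = inj₂ (refl , eq)
xor-true {true} {false} eq = inj₁ (refl , refl)

side-cases : ∀ s t → t ≡ s ⊎ t ≡ opp s
side-cases upper upper = inj₁ refl
side-cases upper lower = inj₂ refl
side-cases lower upper = inj₂ refl
side-cases lower lower = inj₁ refl

module _ {n : ℕ} {α : Diag n} (nc : Noncrossing α) where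
  open Noncrossing nc

  -- The alternating walk that starts at j with an arc on the side opposite to s;
  -- Walk s j k t x says that after k steps it is at x and is to leave it on side t.
  data Walk (s : Side) (j : Fin n) : ℕ → Side → Fin n → Set where
    start : Walk s j 0 (opp s) j
    step : ∀ {k t x y} → Walk s j k t x → Arc α t x y → Walk s j (suc k) (opp t) y

  module _ {s : Side} {j : Fin n} where

    walk-fun : ∀ {k t x t′ x′} → Walk s j k t x → Walk s j k t′ x′ → t ≡ t′ × x ≡ x′
    walk-fun start start = refl , refl
    walk-fun (step W p) (step W′ p′) with walk-fun W W′
    ... | refl , refl = refl , arc-fun {α = α} _ p p′

    -- The walk is deterministic, so it cannot get past a vertex that has no arc on the exit side.
    walk-stop : ∀ {k t x k′ t′ x′} → Walk s j k t x → NoArc α t x → Walk s j k′ t′ x′ → k′ ℕ.≤ k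
    walk-stop W stop start = z≤n
    walk-stop {k} W stop (step {k′} W′ p) with ℕₚ.m≤n⇒m<n∨m≡n (walk-stop W stop W′)
    ... | inj₁ lt = lt
    ... | inj₂ refl with walk-fun W W′
    ...   | refl , refl = ⊥-elim (stop p)

    -- An edge at a vertex of the walk leads on to the next vertex or, on the side of arrival, back
    -- to the previous one; at the start this other side is `s`, where `j` has no arc. Hence the
    -- walk exhausts the component of `j`.
    walk-extend : NoArc α s j → ∀ {k t x y} → Walk s j k t x → Adj α x y →
      ∃ λ k′ → ∃ λ t′ → Walk s j k′ t′ y
    walk-extend stop {t = t} W (t′ , p) with side-cases t t′
    ... | inj₁ refl = _ , _ , step W p
    walk-extend stop start (t′ , p) | inj₂ refl =
      ⊥-elim (stop (subst (λ t → Arc α t _ _) (opp-opp s) p))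
    walk-extend stop (step {t = t} W q) (t′ , p) | inj₂ refl
      rewrite opp-opp t with arc-fun {α = α} t p (arc-sym t q)
    ... | refl = _ , _ , W

    linked⇒walk : NoArc α s j → ∀ {k t x y} → Walk s j k t x → Linked α x y →
      ∃ λ k′ → ∃ λ t′ → Walk s j k′ t′ y
    linked⇒walk stop W ε = _ , _ , W
    linked⇒walk stop W (e ◅ es) with walk-extend stop W e
    ... | _ , _ , W′ = linked⇒walk stop W′ es

    -- After at least one step there is an arc on the side of arrival, `opp t`, so that only the
    -- exit side can lack one.
    walk-end : ∀ {w k t} → Walk s j k t w → ∀ r → NoArc α r w → t ≡ r ⊎ (w ≡ j × t ≡ opp s)
    walk-end start r stop = inj₂ (refl , refl)
    walk-end (step {t = t} W p) r stop with side-cases t r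
    ... | inj₁ refl = ⊥-elim (stop (arc-sym r p))
    ... | inj₂ refl = inj₁ refl

    walk-end-opp : ∀ {w k t} → Walk s j k t w → NoArc α (opp s) w → t ≡ opp s
    walk-end-opp W now with walk-end W (opp s) now
    ... | inj₁ eq = eq
    ... | inj₂ (_ , eq) = eq

    -- The walk stops at `i`, for want of an arc on side `opp s`, and also at any `w` other than
    -- `j`, for want of one on side `s`. By `walk-stop` both happen after the same number of steps,
    -- but then the exit sides would agree.
    end-unique : ∀ {i w} → NoArc α s j → NoArc α (opp s) i → Linked α j i →
      Linked α j w → NoArc α s w → w ≡ j
    end-unique noj noi j~i j~w now with linked⇒walk noj start j~i | linked⇒walk noj start j~w
    ... | _ , _ , W | _ , _ , W′ with walk-end-opp W noi | walk-end W′ s now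
    ...   | _ | inj₂ (eq , _) = eq
    ...   | refl | inj₁ refl = ⊥-elim (clash (ℕₚ.≤-antisym (walk-stop W′ now W) (walk-stop W noi W′)) W W′)
      where
      clash : ∀ {k k′ x x′} → k ≡ k′ → Walk s j k (opp s) x → Walk s j k′ s x′ → ⊥
      clash refl W W′ = s≢opp s (sym (proj₁ (walk-fun W W′)))

  record Exposed (s : Side) (x : Fin n) : Set where
    field
      bare : NoArc α s x
      uncovered : ∀ {a b} → Arc α s a b → a < x → ¬ x < b

  -- The ends need not form a transversal: `cut-through` considers strands between ends of different
  -- transversals in order to refute them.
  record Strand (e : Side → Fin n) : Set where
    field
      exposed : ∀ s → Exposed s (e s)
      joined : Linked α (e upper) (e lower)

    bare : ∀ s → NoArc α s (e s)
    bare s = Exposed.bare (exposed s)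

    strand-end : ∀ s {w} → Linked α (e upper) w → NoArc α s w → w ≡ e s
    strand-end upper e~w now = end-unique (bare upper) (bare lower) joined e~w now
    strand-end lower e~w now =
      end-unique (bare lower) (bare upper) (linked-sym joined) (linked-sym joined ◅◅ e~w) now

  module _ {e : Side → Fin n} (E : Strand e) where
    open Strand E

    inside : Fin n → Bool
    inside = comp α (e upper)

    inside-adj : ∀ {x y} → inside x ≡ true → Adj α x y → inside y ≡ true
    inside-adj = comp-closed α (e upper)

    end-inside : ∀ s → inside (e s) ≡ true
    end-inside upper = comp-complete α (e upper) ε
    end-inside lower = comp-complete α (e upper) joined

    -- The parity of the number of strand vertices left of v decides on which side of the strand v lies.
    below : Fin n → Fin n → Bool
    below v x = inside x ∧ (x <ᶠ v)

    inside-arc : ∀ s {x} → inside x ≡ true → x ≢ e s → ∃ λ y → Arc α s x y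
    inside-arc s {x} Px x≢e with arc? α s x
    ... | inj₁ h = h
    ... | inj₂ none = ⊥-elim (x≢e (strand-end s (comp-sound α (e upper) Px) none))

    -- The end `e s` is the only strand vertex without an arc on side `s`; a set of strand vertices
    -- that avoids it and is not left by these arcs is matched by them.
    even-below : ∀ s {C : Fin n → Bool} →
      (∀ x → C x ≡ true → inside x ≡ true × x ≢ e s × (∀ {y} → Arc α s x y → inside y ≡ true → C y ≡ true)) →
      parity C ≡ false
    even-below s {C} h = parity-matched {M = Arc α s} (arc-sym s) (arc-irr s) (arc-fun {α = α} s) C λ x Cx →
      let Px , x≢e , next = h x Cx ; y , p = inside-arc s Px x≢e
      in y , p , next p (inside-adj Px (s , p))

    -- The strand vertices under the arc are matched by arcs of side `s`: these do not cross the
    -- given arc, and the exposed end `e s` is not covered by it.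
    below-arc-< : ∀ s {v w} → Arc α s v w → v < w → inside v ≡ false → inside w ≡ false →
      parity (below v) ≡ parity (below w)
    below-arc-< s {v} {w} p v<w Pv Pw = xor-false (trans (sym (parity-xor (below v) (below w))) (even-below s between))
      where
      C : Fin n → Bool
      -- As `v < w`, the symmetric difference of the two initial segments is the part of the strand
      -- between `v` and `w`.
      C x = below v x xor below w x
      member : ∀ {x} → inside x ≡ true → v < x → x < w → C x ≡ true
      member Px v<x x<w rewrite Px | ≮⇒<ᶠ (Finₚ.<-asym v<x) | <⇒<ᶠ x<w = refl
      between : ∀ x → C x ≡ true → inside x ≡ true × x ≢ e s × (∀ {y} → Arc α s x y → inside y ≡ true → C y ≡ true)
      between x Cx with xor-true {below v x} Cx
      ... | inj₁ (bv , bw) = let Px , x<v = ∧-true {inside x} bv in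
            ⊥-elim (true≢false (true-∧ Px (<⇒<ᶠ (Finₚ.<-trans (<ᶠ⇒< x<v) v<w))) bw)
      ... | inj₂ (bv , bw) = Px , (λ { refl → Exposed.uncovered (exposed s) p v<x x<w }) , next
        where
        Px : inside x ≡ true
        Px = proj₁ (∧-true {inside x} bw)
        x<w : x < w
        x<w = <ᶠ⇒< (proj₂ (∧-true {inside x} bw))
        v<x : v < x
        v<x with Finₚ.<-cmp v x
        ... | tri< lt _ _ = lt
        ... | tri≈ _ refl _ = ⊥-elim (true≢false Px Pv)
        ... | tri> _ _ x<v = ⊥-elim (true≢false (true-∧ Px (<⇒<ᶠ x<v)) bv)
        next : ∀ {y} → Arc α s x y → inside y ≡ true → C y ≡ true
        next {y} q Py with Finₚ.<-cmp v y | Finₚ.<-cmp y w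
        ... | tri< v<y _ _ | tri< y<w _ _ = member Py v<y y<w
        ... | tri≈ _ refl _ | _ = ⊥-elim (true≢false Py Pv)
        ... | _ | tri≈ _ refl _ = ⊥-elim (true≢false Py Pw)
        ... | tri> _ _ y<v | _ = ⊥-elim (no-cross s (arc-sym s q) p y<v v<x x<w)
        ... | _ | tri> _ _ w<y = ⊥-elim (no-cross s p q v<x x<w w<y)

    below-adj : ∀ {v w} → Adj α v w → inside v ≡ false → inside w ≡ false → parity (below v) ≡ parity (below w)
    below-adj {v} {w} (s , p) Pv Pw with Finₚ.<-cmp v w
    ... | tri< v<w _ _ = below-arc-< s p v<w Pv Pw
    ... | tri≈ _ refl _ = refl
    ... | tri> _ _ w<v = sym (below-arc-< s (arc-sym s p) w<v Pw Pv)

    outside-adj : ∀ {v w} → inside v ≡ false → Adj α v w → inside w ≡ false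
    outside-adj Pv (s , p) = ≢true⇒≡false λ Pw → true≢false (inside-adj Pw (s , arc-sym s p)) Pv

    below-linked : ∀ {v w} → inside v ≡ false → Linked α v w → parity (below v) ≡ parity (below w)
    below-linked Pv ε = refl
    below-linked Pv (a ◅ as) = trans (below-adj a Pv (outside-adj Pv a)) (below-linked (outside-adj Pv a) as)

    module _ (s : Side) {x′ : Fin n} (X : Exposed s x′) (x′∉ : inside x′ ≡ false) where
      open Exposed X using (uncovered)

      below-next : ∀ {x y} → x < x′ → Arc α s x y → inside y ≡ true → y < x′
      below-next {y = y} x<x′ q Py with Finₚ.<-cmp y x′
      ... | tri< lt _ _ = lt
      ... | tri≈ _ refl _ = ⊥-elim (true≢false Py x′∉)
      ... | tri> _ _ gt = ⊥-elim (uncovered q x<x′ gt)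

      -- No arc of side `s` passes over the exposed vertex `x′`, so the strand vertices to its left
      -- are matched among themselves, except for `e s` if it is one of them. Together with
      -- `below-left`, the parity thus tells on which side of `x′` the end `e s` lies.
      below-right : e s < x′ → parity (below x′) ≡ true
      below-right lt = trans (parity-∖ {C = below x′} (e s) (true-∧ (end-inside s) (<⇒<ᶠ lt)))
        (cong not (even-below s λ x Cx →
          let bx , x≢e = ∈-∖ {C = below x′} Cx ; Px , x<x′ = ∧-true {inside x} bx in
          Px , x≢e , λ q Py → ∖-∈ {C = below x′} (true-∧ Py (<⇒<ᶠ (below-next (<ᶠ⇒< x<x′) q Py)))
            λ { refl → bare s (arc-sym s q) }))

      below-left : ¬ e s < x′ → parity (below x′) ≡ false
      below-left nlt = even-below s λ x Cx →
        let Px , x<x′ = ∧-true {inside x} Cx in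
        Px , (λ { refl → nlt (<ᶠ⇒< x<x′) }) , λ q Py → true-∧ Py (<⇒<ᶠ (below-next (<ᶠ⇒< x<x′) q Py))

  -- The parity of the first strand is the same at both ends of the second, by `below-linked`. At
  -- the upper end it records the order of the upper ends, at the lower end that of the lower ends.
  strands-ordered : ∀ {e e′} → Strand e → Strand e′ → e upper < e′ upper → e lower < e′ lower
  strands-ordered {e} {e′} E E′ lt with e lower Finₚ.<? e′ lower
  ... | yes lt′ = lt′
  ... | no nlt = ⊥-elim (true≢false (below-right E upper (exposed upper) u∉ lt)
        (trans (below-linked E u∉ joined) (below-left E lower (exposed lower) l∉ nlt)))
    where
    open Strand E′
    apart : ¬ Linked α (e upper) (e′ upper)
    apart e~e′ = Finₚ.<-irrefl (sym (Strand.strand-end E upper e~e′ (bare upper))) lt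
    u∉ : inside E (e′ upper) ≡ false
    u∉ = ≢true⇒≡false (apart ∘ comp-sound α (e upper))
    l∉ : inside E (e′ lower) ≡ false
    l∉ = ≢true⇒≡false λ h → apart (comp-sound α (e upper) h ◅◅ linked-sym joined)

-- Idempotents

Through : ∀ {n} → Diag n → Set
Through α = ∀ {j i} → Tr α upper j i → Linked α j i

ends : ∀ {n} → Fin n → Fin n → Side → Fin n
ends j i upper = j
ends j i lower = i

module _ {n : ℕ} {α : Diag n} (nc : Noncrossing α) where
  open Noncrossing nc

  tr-exposed : ∀ s {a b} → Tr α s a b → Exposed nc s a
  tr-exposed s p = record { bare = tr⇒noArc {α = α} s p ; uncovered = λ q → no-cover s q p }

  tr-strand : ∀ {j i} → Tr α upper j i → Linked α j i → Strand nc (ends j i)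
  tr-strand p j~i = record
    { exposed = λ { upper → tr-exposed upper p ; lower → tr-exposed lower (tr-sym upper p) }
    ; joined = j~i }

  data Node : Set where
    outer : Side → Fin n → Node
    middle : Fin n → Node

  node : Row3 n → Node
  node (top a) = outer upper a
  node (mid a) = middle a
  node (bot a) = outer lower a

  -- Two stacked copies of α, described alike for both outer rows. In the middle row the lower arcs
  -- of the first copy and the upper arcs of the second make up the interface graph; each
  -- transversal leads from its own outer row to the middle.
  data Move : Node → Node → Set where
    along : ∀ {s a b} → Arc α s a b → Move (outer s a) (outer s b)
    inward : ∀ {s a b} → Tr α s a b → Move (outer s a) (middle b)
    outward : ∀ {s a b} → Tr α s b a → Move (middle a) (outer s b)
    across : ∀ {a b} → Adj α a b → Move (middle a) (middle b)

  move-sym : ∀ {x y} → Move x y → Move y x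
  move-sym (along {s} p) = along (arc-sym s p)
  move-sym (inward p) = outward p
  move-sym (outward p) = inward p
  move-sym (across (s , p)) = across (s , arc-sym s p)

  step⇒move : ∀ {x y} → Step α α x y → Move (node x) (node y)
  step⇒move (viaα (inj₁ a) (inj₁ b) p) = along p
  step⇒move (viaα (inj₁ a) (inj₂ b) p) = inward p
  step⇒move (viaα (inj₂ a) (inj₁ b) p) = outward (tr-sym lower p)
  step⇒move (viaα (inj₂ a) (inj₂ b) p) = across (lower , p)
  step⇒move (viaβ (inj₁ a) (inj₁ b) p) = across (upper , p)
  step⇒move (viaβ (inj₁ a) (inj₂ b) p) = outward (tr-sym upper p)
  step⇒move (viaβ (inj₂ a) (inj₁ b) p) = inward p
  step⇒move (viaβ (inj₂ a) (inj₂ b) p) = along p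

  conn⇒moves : ∀ {x y} → Conn α α x y → Star Move (node x) (node y)
  conn⇒moves = gmap node λ { (inj₁ st) → step⇒move st ; (inj₂ st) → move-sym (step⇒move st) }

  invariant : ∀ (P : Node → Set) → (∀ {x y} → P x → Move x y → P y) → ∀ {x y} → P x → Star Move x y → P y
  invariant P pres Px ε = Px
  invariant P pres Px (m ◅ ms) = invariant P pres (pres Px m) ms

  -- The component of `middle y`: it leaves the middle row along transversals only, and an outer
  -- vertex on a transversal has no arc by which to go on.
  Touches : Fin n → Node → Set
  Touches y (middle x) = Linked α y x
  Touches y (outer s a) = ∃ λ x → Tr α s a x × Linked α y x

  touches-move : ∀ {y x z} → Touches y x → Move x z → Touches y z
  touches-move (_ , q , _) (along {s} p) = ⊥-elim (tr⇒noArc {α = α} s q p)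
  touches-move (_ , q , l) (inward {s} p) rewrite tr-fun {α = α} s p q = l
  touches-move l (outward p) = _ , p , l
  touches-move l (across e) = l ◅◅ e ◅ ε

  single-moves : ∀ {s a z} → partner α (vtx s a) ≡ nothing → Star Move (outer s a) z → z ≡ outer s a
  single-moves {s} {a} eq = invariant (_≡ outer s a) stuck refl
    where
    clash : ∀ {x : V n} → nothing ≡ just x → ⊥
    clash ()
    stuck : ∀ {x y} → x ≡ outer s a → Move x y → y ≡ outer s a
    stuck refl (along p) = ⊥-elim (clash (trans (sym eq) p))
    stuck refl (inward p) = ⊥-elim (clash (trans (sym eq) p))

  arc-moves : ∀ {s a b z} → Arc α s a b → Star Move (outer s a) z → z ≡ outer s a ⊎ z ≡ outer s b
  arc-moves {s} {a} {b} p = invariant (λ z → z ≡ outer s a ⊎ z ≡ outer s b) stuck (inj₁ refl)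
    where
    stuck : ∀ {x y} → x ≡ outer s a ⊎ x ≡ outer s b → Move x y → y ≡ outer s a ⊎ y ≡ outer s b
    stuck (inj₁ refl) (along q) = inj₂ (cong (outer s) (arc-fun {α = α} s q p))
    stuck (inj₁ refl) (inward q) = ⊥-elim (tr⇒noArc {α = α} s q p)
    stuck (inj₂ refl) (along q) = inj₁ (cong (outer s) (arc-fun {α = α} s q (arc-sym s p)))
    stuck (inj₂ refl) (inward q) = ⊥-elim (tr⇒noArc {α = α} s q (arc-sym s p))

  -- The first copy of the transversal arrives at the middle vertex `i`. From there the bottom
  -- vertex `i` must be reached, and the only way down to it is the second copy, which leaves from
  -- the middle vertex `j`.
  idempotent⇒through : IsProduct α α α → Through α
  idempotent⇒through prod {j} {i} p
    with invariant (Touches i) touches-move (i , p , ε)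
           (conn⇒moves (Equivalence.to (prod (inj₁ j) (inj₂ i)) (inj₂ p)))
  ... | x , q , i~x rewrite tr-fun {α = α} lower q (tr-sym upper p) = linked-sym i~x

  linked⇒conn : ∀ {a b} → Linked α a b → Conn α α (mid a) (mid b)
  linked⇒conn = gmap mid λ { (upper , p) → inj₁ (viaβ _ _ p) ; (lower , p) → inj₁ (viaα _ _ p) }

  module _ (H : Through α) where

    block⇒conn : ∀ x y → partner α x ≡ just y → Conn α α (ιout x) (ιout y)
    block⇒conn (inj₁ a) (inj₁ b) p = inj₁ (viaα _ _ p) ◅ ε
    block⇒conn (inj₂ a) (inj₂ b) p = inj₁ (viaβ _ _ p) ◅ ε
    -- Down to the middle vertex `b`, through the interface graph to `a`, and down again by the
    -- second copy.
    block⇒conn (inj₁ a) (inj₂ b) p =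
      inj₁ (viaα (inj₁ a) (inj₂ b) p) ◅ (linked⇒conn (linked-sym (H p)) ◅◅ inj₁ (viaβ (inj₁ a) (inj₂ b) p) ◅ ε)
    block⇒conn (inj₂ b) (inj₁ a) p =
      inj₁ (viaβ (inj₂ b) (inj₁ a) p) ◅ (linked⇒conn (H (tr-sym lower p)) ◅◅ inj₁ (viaα (inj₂ b) (inj₁ a) p) ◅ ε)

    -- A middle vertex on a transversal is bare on the side of that transversal, and the strand
    -- through `b` has a single bare vertex on each side. So only the two ends of the given block
    -- are met in the outer rows.
    tr-touches : ∀ s t {a b k} → Tr α s a b → Touches b (outer t k) → SameBlock α (vtx s a) (vtx t k)
    tr-touches upper upper p (y , q , b~y)
      with Strand.strand-end (tr-strand p (H p)) lower (H p ◅◅ b~y) (tr⇒noArc {α = α} lower (tr-sym upper q))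
    ... | refl = inj₁ (cong inj₁ (tr-fun {α = α} lower (tr-sym upper p) (tr-sym upper q)))
    tr-touches upper lower p (y , q , b~y)
      with Strand.strand-end (tr-strand p (H p)) upper (H p ◅◅ b~y) (tr⇒noArc {α = α} upper (tr-sym lower q))
    ... | refl = inj₂ (tr-sym lower q)
    tr-touches lower upper p (y , q , b~y)
      with Strand.strand-end (tr-strand (tr-sym lower p) (H (tr-sym lower p))) lower b~y (tr⇒noArc {α = α} lower (tr-sym upper q))
    ... | refl = inj₂ (tr-sym upper q)
    tr-touches lower lower p (y , q , b~y)
      with Strand.strand-end (tr-strand (tr-sym lower p) (H (tr-sym lower p))) upper b~y (tr⇒noArc {α = α} upper (tr-sym lower q))
    ... | refl = inj₁ (cong inj₂ (tr-fun {α = α} upper (tr-sym lower p) (tr-sym lower q)))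

    moves⇒block : ∀ s t {a b} → Star Move (outer s a) (outer t b) → SameBlock α (vtx s a) (vtx t b)
    moves⇒block s t {a} ms with block α s a
    moves⇒block s t ms | single eq with refl ← single-moves {s} eq ms = inj₁ refl
    moves⇒block s t ms | arc b p with arc-moves p ms
    ... | inj₁ refl = inj₁ refl
    ... | inj₂ refl = inj₂ p
    moves⇒block s t ms | tr b p = tr-touches s t p (invariant (Touches b) touches-move (b , p , ε) ms)

    conn⇒block : ∀ x y → Conn α α (ιout x) (ιout y) → SameBlock α x y
    conn⇒block (inj₁ a) (inj₁ b) c = moves⇒block upper upper (conn⇒moves c)
    conn⇒block (inj₁ a) (inj₂ b) c = moves⇒block upper lower (conn⇒moves c)
    conn⇒block (inj₂ a) (inj₁ b) c = moves⇒block lower upper (conn⇒moves c)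
    conn⇒block (inj₂ a) (inj₂ b) c = moves⇒block lower lower (conn⇒moves c)

    through⇒idempotent : IsProduct α α α
    through⇒idempotent x y = mk⇔ (λ { (inj₁ refl) → ε ; (inj₂ p) → block⇒conn x y p }) (conn⇒block x y)

-- Consecutive pairs in a list

module _ {A B : Set} {g : A → Maybe B} where

  ∈-mapMaybe⁺ : ∀ {a b xs} → a ∈ xs → g a ≡ just b → b ∈ mapMaybe g xs
  ∈-mapMaybe⁺ {xs = x ∷ _} (here refl) eq rewrite eq = here refl
  ∈-mapMaybe⁺ {xs = x ∷ _} (there a∈) eq with g x
  ... | just _ = there (∈-mapMaybe⁺ a∈ eq)
  ... | nothing = ∈-mapMaybe⁺ a∈ eq

  ∈-mapMaybe⁻ : ∀ {b} xs → b ∈ mapMaybe g xs → ∃ λ a → a ∈ xs × g a ≡ just b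
  ∈-mapMaybe⁻ (x ∷ xs) b∈ with g x in eq
  ∈-mapMaybe⁻ (x ∷ xs) (here refl) | just _ = x , here refl , eq
  ∈-mapMaybe⁻ (x ∷ xs) (there b∈) | just _ = let a , a∈ , h = ∈-mapMaybe⁻ xs b∈ in a , there a∈ , h
  ... | nothing = let a , a∈ , h = ∈-mapMaybe⁻ xs b∈ in a , there a∈ , h

  mapMaybe-allPairs : ∀ {Q : A → A → Set} {R : B → B → Set} →
    (∀ {a a′ b b′} → Q a a′ → g a ≡ just b → g a′ ≡ just b′ → R b b′) →
    ∀ {xs} → AllPairs Q xs → AllPairs R (mapMaybe g xs)
  mapMaybe-allPairs h [] = []
  mapMaybe-allPairs {R = R} h {x ∷ xs} (qs ∷ ap) with g x in eq
  ... | nothing = mapMaybe-allPairs h ap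
  ... | just b = All.tabulate (λ b′∈ → let a′ , a′∈ , eq′ = ∈-mapMaybe⁻ xs b′∈ in h (All.lookup qs a′∈) eq eq′)
                 ∷ mapMaybe-allPairs h ap

module _ {A : Set} {R : A → A → Set} where

  ∈-pairUp⁻ : ∀ {x y} (xs : List A) → (x , y) ∈ pairUp xs → x ∈ xs × y ∈ xs
  ∈-pairUp⁻ (a ∷ b ∷ r) (here refl) = here refl , there (here refl)
  ∈-pairUp⁻ (a ∷ b ∷ r) (there p) = let x∈ , y∈ = ∈-pairUp⁻ r p in there (there x∈) , there (there y∈)

  pairUp-related : ∀ {x y xs} → AllPairs R xs → (x , y) ∈ pairUp xs → R x y
  pairUp-related ((r ∷ _) ∷ _ ∷ _) (here refl) = r
  pairUp-related (_ ∷ _ ∷ ap) (there p) = pairUp-related ap p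

  pairUp-adjacent : ∀ {x y z xs} → AllPairs R xs → (x , y) ∈ pairUp xs → z ∈ xs →
    (z ≡ x ⊎ R z x) ⊎ (z ≡ y ⊎ R y z)
  pairUp-adjacent {xs = _ ∷ _ ∷ _} _ (here refl) (here refl) = inj₁ (inj₁ refl)
  pairUp-adjacent {xs = _ ∷ _ ∷ _} _ (here refl) (there (here refl)) = inj₂ (inj₁ refl)
  pairUp-adjacent (_ ∷ rs ∷ _) (here refl) (there (there z∈)) = inj₂ (inj₂ (All.lookup rs z∈))
  pairUp-adjacent {xs = _ ∷ _ ∷ r} ((_ ∷ rs) ∷ _) (there p) (here refl) =
    inj₁ (inj₂ (All.lookup rs (proj₁ (∈-pairUp⁻ r p))))
  pairUp-adjacent {xs = _ ∷ _ ∷ r} (_ ∷ rs ∷ _) (there p) (there (here refl)) =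
    inj₁ (inj₂ (All.lookup rs (proj₁ (∈-pairUp⁻ r p))))
  pairUp-adjacent (_ ∷ _ ∷ ap) (there p) (there (there z∈)) = pairUp-adjacent ap p z∈

  -- A list of odd length has its last element unpaired; the fields express this last place through
  -- the order.
  record Leftover (xs : List A) (z : A) : Set where
    field
      after-pairs : ∀ {x y} → (x , y) ∈ pairUp xs → R x z × R y z
      last : ∀ {w} → w ∈ xs → w ≡ z ⊎ R w z

  data PairUpView (xs : List A) (z : A) : Set where
    first : ∀ {y} → (z , y) ∈ pairUp xs → PairUpView xs z
    second : ∀ {x} → (x , z) ∈ pairUp xs → PairUpView xs z
    leftover : Leftover xs z → PairUpView xs z

  pairUp-view : ∀ {z xs} → AllPairs R xs → z ∈ xs → PairUpView xs z
  pairUp-view {xs = _ ∷ []} _ (here refl) = leftover record { after-pairs = λ () ; last = λ { (here refl) → inj₁ refl } }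
  pairUp-view {xs = _ ∷ _ ∷ _} _ (here refl) = first (here refl)
  pairUp-view {xs = _ ∷ _ ∷ _} _ (there (here refl)) = second (here refl)
  pairUp-view {xs = a ∷ b ∷ r} ((_ ∷ as) ∷ bs ∷ ap) (there (there z∈)) with pairUp-view ap z∈
  ... | first p = first (there p)
  ... | second p = second (there p)
  ... | leftover lo = leftover record
        { after-pairs = λ { (here refl) → All.lookup as z∈ , All.lookup bs z∈ ; (there p) → Leftover.after-pairs lo p }
        ; last = λ { (here refl) → inj₂ (All.lookup as z∈) ; (there (here refl)) → inj₂ (All.lookup bs z∈)
                   ; (there (there w∈)) → Leftover.last lo w∈ } }

-- The hat map

at : ∀ {n} → Side → Fin n × Fin n → Fin n
at upper = proj₁
at lower = proj₂

_≺_ : ∀ {n} → Fin n × Fin n → Fin n × Fin n → Set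
x ≺ y = ∀ s → at s x < at s y

-- Common form of `hatUp` and `hatLow`, so that the two rows need not be treated separately.
rematch : ∀ {n} → Side → List ((Fin n × Fin n) × (Fin n × Fin n)) → Fin n → Maybe (V n) → Maybe (V n)
rematch s [] a old = old
rematch s ((x , y) ∷ ps) a old =
  if a == at s x then just (vtx s (at s y)) else (if a == at s y then just (vtx s (at s x)) else rematch s ps a old)

module _ {n : ℕ} (s : Side) where

  -- In a sorted list the members of all earlier pairs are smaller, so the tests against them fail.
  rematch-first : ∀ {x y : Fin n × Fin n} {xs old} → AllPairs _≺_ xs → (x , y) ∈ pairUp xs →
    rematch s (pairUp xs) (at s x) old ≡ just (vtx s (at s y))
  rematch-first {x} {xs = _ ∷ _ ∷ _} _ (here refl) rewrite ==-refl (at s x) = refl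
  rematch-first {x} {xs = a ∷ b ∷ r} ((_ ∷ as) ∷ bs ∷ ap) (there p)
    rewrite ≢⇒== (λ eq → Finₚ.<-irrefl (sym eq) (All.lookup as (proj₁ (∈-pairUp⁻ {R = _≺_} r p)) s))
          | ≢⇒== (λ eq → Finₚ.<-irrefl (sym eq) (All.lookup bs (proj₁ (∈-pairUp⁻ {R = _≺_} r p)) s))
    = rematch-first ap p

  rematch-second : ∀ {x y : Fin n × Fin n} {xs old} → AllPairs _≺_ xs → (x , y) ∈ pairUp xs →
    rematch s (pairUp xs) (at s y) old ≡ just (vtx s (at s x))
  rematch-second {y = y} ((r ∷ _) ∷ _ ∷ _) (here refl)
    rewrite ≢⇒== (λ eq → Finₚ.<-irrefl (sym eq) (r s)) | ==-refl (at s y) = refl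
  rematch-second {xs = a ∷ b ∷ r} ((_ ∷ as) ∷ bs ∷ ap) (there p)
    rewrite ≢⇒== (λ eq → Finₚ.<-irrefl (sym eq) (All.lookup as (proj₂ (∈-pairUp⁻ {R = _≺_} r p)) s))
          | ≢⇒== (λ eq → Finₚ.<-irrefl (sym eq) (All.lookup bs (proj₂ (∈-pairUp⁻ {R = _≺_} r p)) s))
    = rematch-second ap p

  rematch-other : ∀ {a old} (ps : List ((Fin n × Fin n) × (Fin n × Fin n))) →
    (∀ {x y} → (x , y) ∈ ps → a ≢ at s x × a ≢ at s y) → rematch s ps a old ≡ old
  rematch-other [] h = refl
  rematch-other (_ ∷ ps) h rewrite ≢⇒== (proj₁ (h (here refl))) | ≢⇒== (proj₂ (h (here refl))) =
    rematch-other ps (h ∘ there)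

module _ {n : ℕ} (α : Diag n) where

  hatUp-rematch : ∀ ps j old → hatUp {n} ps j old ≡ rematch upper ps j old
  hatUp-rematch [] j old = refl
  hatUp-rematch (((j₁ , i₁) , (j₂ , i₂)) ∷ ps) j old rewrite hatUp-rematch ps j old = refl

  hatLow-rematch : ∀ ps j old → hatLow {n} ps j old ≡ rematch lower ps j old
  hatLow-rematch [] j old = refl
  hatLow-rematch (((j₁ , i₁) , (j₂ , i₂)) ∷ ps) j old rewrite hatLow-rematch ps j old = refl

  hat-rematch : ∀ s a → partner (hat α) (vtx s a) ≡ rematch s (pairUp (transversals α)) a (partner α (vtx s a))
  hat-rematch upper a = trans (lookup∘tabulate _ a) (hatUp-rematch (pairUp (transversals α)) a _)
  hat-rematch lower a = trans (lookup∘tabulate _ a) (hatLow-rematch (pairUp (transversals α)) a _)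

  transv⇒tr : ∀ {j x} → transv α j ≡ just x → proj₁ x ≡ j × Tr α upper j (proj₂ x)
  transv⇒tr {j} eq with lookup (up α) j
  transv⇒tr {j} refl | just (inj₂ i) = refl , refl

  tr⇒transv : ∀ {j i} → Tr α upper j i → transv α j ≡ just (j , i)
  tr⇒transv {j} eq with lookup (up α) j
  tr⇒transv {j} refl | just (inj₂ i) = refl

  ∈-transversals⁺ : ∀ {j i} → Tr α upper j i → (j , i) ∈ transversals α
  ∈-transversals⁺ {j} p = ∈-mapMaybe⁺ (∈-allFin j) (tr⇒transv p)

  ∈-transversals⁻ : ∀ {j i} → (j , i) ∈ transversals α → Tr α upper j i
  ∈-transversals⁻ z∈ with ∈-mapMaybe⁻ (allFin n) z∈
  ... | _ , _ , eq with transv⇒tr eq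
  ...   | refl , p = p

module _ {n : ℕ} {α : Diag n} (nc : Noncrossing α) (ord : OrderedTr α) where
  open Noncrossing nc

  transversals-sorted : AllPairs _≺_ (transversals α)
  transversals-sorted = mapMaybe-allPairs sorted (tabulate⁺-< (λ i<j → i<j))
    where
    sorted : ∀ {a a′ x x′} → a < a′ → transv α a ≡ just x → transv α a′ ≡ just x′ → x ≺ x′
    sorted a<a′ eq eq′ with transv⇒tr α eq | transv⇒tr α eq′
    ... | refl , p | refl , p′ = λ { upper → a<a′ ; lower → ord p p′ a<a′ }

  Pair : Fin n × Fin n → Fin n × Fin n → Set
  Pair x y = (x , y) ∈ pairUp (transversals α)

  at-tr : ∀ {x} s → x ∈ transversals α → Tr α s (at s x) (at (opp s) x)
  at-tr upper x∈ = ∈-transversals⁻ α x∈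
  at-tr lower x∈ = tr-sym upper (∈-transversals⁻ α x∈)

  tr-at : ∀ s {a b} → Tr α s a b → ∃ λ x → x ∈ transversals α × a ≡ at s x × b ≡ at (opp s) x
  tr-at upper p = _ , ∈-transversals⁺ α p , refl , refl
  tr-at lower p = _ , ∈-transversals⁺ α (tr-sym lower p) , refl , refl

  pair-∈ : ∀ {x y} → Pair x y → x ∈ transversals α × y ∈ transversals α
  pair-∈ = ∈-pairUp⁻ {R = _≺_} (transversals α)

  pair-≺ : ∀ {x y} → Pair x y → x ≺ y
  pair-≺ = pairUp-related transversals-sorted

  pair-adjacent : ∀ {x y} s {t c} → Pair x y → Tr α s t c → at s x < t → ¬ t < at s y
  pair-adjacent s xy p x<t t<y with tr-at s p
  ... | z , z∈ , refl , _ with pairUp-adjacent transversals-sorted xy z∈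
  ...   | inj₁ (inj₁ refl) = Finₚ.<-irrefl refl x<t
  ...   | inj₁ (inj₂ z≺x) = Finₚ.<-asym (z≺x s) x<t
  ...   | inj₂ (inj₁ refl) = Finₚ.<-irrefl refl t<y
  ...   | inj₂ (inj₂ y≺z) = Finₚ.<-asym (y≺z s) t<y

  hat-first : ∀ {x y} s → Pair x y → Arc (hat α) s (at s x) (at s y)
  hat-first s xy = trans (hat-rematch α s _) (rematch-first s transversals-sorted xy)

  hat-second : ∀ {x y} s → Pair x y → Arc (hat α) s (at s y) (at s x)
  hat-second s xy = trans (hat-rematch α s _) (rematch-second s transversals-sorted xy)

  data HatView (s : Side) (a : Fin n) : Set where
    plain : (∀ {b} → ¬ Tr α s a b) → partner (hat α) (vtx s a) ≡ partner α (vtx s a) → HatView s a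
    first : ∀ {x y} → Pair x y → a ≡ at s x → HatView s a
    second : ∀ {x y} → Pair x y → a ≡ at s y → HatView s a
    final : ∀ {z} → z ∈ transversals α → Leftover {R = _≺_} (transversals α) z → a ≡ at s z →
      partner (hat α) (vtx s a) ≡ partner α (vtx s a) → HatView s a

  hat-plain : ∀ {s a} → (∀ {b} → ¬ Tr α s a b) → partner (hat α) (vtx s a) ≡ partner α (vtx s a)
  hat-plain {s} h = trans (hat-rematch α s _) (rematch-other s _ λ xy → let x∈ , y∈ = pair-∈ xy in
      (λ { refl → h (at-tr s x∈) }) , λ { refl → h (at-tr s y∈) })

  hat-view : ∀ s a → HatView s a
  hat-view s a with block α s a
  ... | single eq = plain h (hat-plain h)
    where
    h : ∀ {b} → ¬ Tr α s a b
    h p with () ← trans (sym eq) p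
  ... | arc b p = plain (λ q → tr⇒noArc {α = α} s q p) (hat-plain λ q → tr⇒noArc {α = α} s q p)
  ... | tr b p with tr-at s p
  ...   | z , z∈ , refl , _ with pairUp-view transversals-sorted z∈
  ...     | first zy = first zy refl
  ...     | second xz = second xz refl
  ...     | leftover lo = final z∈ lo refl (trans (hat-rematch α s _) (rematch-other s _ λ xy →
              let x≺z , y≺z = Leftover.after-pairs lo xy in
              (λ eq → Finₚ.<-irrefl (sym eq) (x≺z s)) , λ eq → Finₚ.<-irrefl (sym eq) (y≺z s)))

  data HatArc (s : Side) (a b : Fin n) : Set where
    old : Arc α s a b → HatArc s a b
    forth : ∀ {x y} → Pair x y → a ≡ at s x → b ≡ at s y → HatArc s a b
    back : ∀ {x y} → Pair x y → a ≡ at s y → b ≡ at s x → HatArc s a b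

  hat-arc : ∀ s {a b} → Arc (hat α) s a b → HatArc s a b
  hat-arc s {a} p with hat-view s a
  ... | plain _ eq = old (trans (sym eq) p)
  ... | first xy refl = forth xy refl (arc-fun {α = hat α} s p (hat-first s xy))
  ... | second xy refl = back xy refl (arc-fun {α = hat α} s p (hat-second s xy))
  ... | final _ _ _ eq = old (trans (sym eq) p)

  arc-hat : ∀ s {a b} → Arc α s a b → Arc (hat α) s a b
  arc-hat s p = trans (hat-plain λ q → tr⇒noArc {α = α} s q p) p

  hat-tr : ∀ s {a b} → Tr (hat α) s a b → Tr α s a b × ∃ λ z → z ∈ transversals α × Leftover {R = _≺_} (transversals α) z × a ≡ at s z
  hat-tr s {a} p with hat-view s a
  ... | plain h eq = ⊥-elim (h (trans (sym eq) p))
  ... | first xy refl = ⊥-elim (tr⇒noArc {α = hat α} s p (hat-first s xy))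
  ... | second xy refl = ⊥-elim (tr⇒noArc {α = hat α} s p (hat-second s xy))
  ... | final z∈ lo a≡ eq = trans (sym eq) p , _ , z∈ , lo , a≡

  final-tr : ∀ s {z} → z ∈ transversals α → Leftover {R = _≺_} (transversals α) z → Tr (hat α) s (at s z) (at (opp s) z)
  final-tr s {z} z∈ lo with hat-view s (at s z)
  ... | plain h eq = ⊥-elim (h (at-tr s z∈))
  ... | first xy eq = ⊥-elim (Finₚ.<-irrefl (sym eq) (proj₁ (Leftover.after-pairs lo xy) s))
  ... | second xy eq = ⊥-elim (Finₚ.<-irrefl (sym eq) (proj₂ (Leftover.after-pairs lo xy) s))
  ... | final _ _ _ eq = trans eq (at-tr s z∈)

  -- A new arc joins neighbouring transversals and so covers none, not even one that `hat` removes.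
  -- This is why new arcs cross nothing: an arc crossing a new one would cover an end of it, which
  -- lies on a transversal of α.
  hat-cover : ∀ s {a b x y} → Arc (hat α) s a b → Tr α s x y → a < x → x < b → ⊥
  hat-cover s p q a<x x<b with hat-arc s p
  ... | old p′ = no-cover s p′ q a<x x<b
  ... | forth xy refl refl = pair-adjacent s xy q a<x x<b
  ... | back xy refl refl = Finₚ.<-asym (pair-≺ xy s) (Finₚ.<-trans a<x x<b)

  hat-noncrossing : Noncrossing (hat α)
  hat-noncrossing = record
    { arc-sym = hat-sym
    ; arc-irr = hat-irr
    ; tr-sym = hat-tr-sym
    ; no-cross = hat-cross
    ; no-cover = λ s p q → hat-cover s p (proj₁ (hat-tr s q))
    }
    where
    hat-sym : ∀ s {a b} → Arc (hat α) s a b → Arc (hat α) s b a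
    hat-sym s p with hat-arc s p
    ... | old q = arc-hat s (arc-sym s q)
    ... | forth xy refl refl = hat-second s xy
    ... | back xy refl refl = hat-first s xy
    hat-irr : ∀ s {a} → ¬ Arc (hat α) s a a
    hat-irr s p with hat-arc s p
    ... | old q = arc-irr s q
    ... | forth xy eq eq′ = Finₚ.<-irrefl (trans (sym eq) eq′) (pair-≺ xy s)
    ... | back xy eq eq′ = Finₚ.<-irrefl (trans (sym eq′) eq) (pair-≺ xy s)
    hat-tr-sym : ∀ s {a b} → Tr (hat α) s a b → Tr (hat α) (opp s) b a
    hat-tr-sym s p with hat-tr s p
    ... | q , z , z∈ , lo , refl with tr-fun {α = α} s q (at-tr s z∈)
    hat-tr-sym upper p | q , z , z∈ , lo , refl | refl = final-tr lower z∈ lo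
    hat-tr-sym lower p | q , z , z∈ , lo , refl | refl = final-tr upper z∈ lo
    hat-cross : ∀ s {a b c d} → Arc (hat α) s a b → Arc (hat α) s c d → a < c → c < b → b < d → ⊥
    hat-cross s p q a<c c<b b<d with hat-arc s p | hat-arc s q
    ... | old p′ | old q′ = no-cross s p′ q′ a<c c<b b<d
    ... | _ | forth xy refl refl = hat-cover s p (at-tr s (proj₁ (pair-∈ xy))) a<c c<b
    ... | _ | back xy refl refl = hat-cover s p (at-tr s (proj₂ (pair-∈ xy))) a<c c<b
    ... | forth xy refl refl | old _ = hat-cover s q (at-tr s (proj₂ (pair-∈ xy))) c<b b<d
    ... | back xy refl refl | old _ = hat-cover s q (at-tr s (proj₁ (pair-∈ xy))) c<b b<d

  hat-orderedTr : OrderedTr (hat α)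
  hat-orderedTr p q = ord (proj₁ (hat-tr upper p)) (proj₁ (hat-tr upper q))

  hat-tr-unique : ∀ {j i j′ i′} → Tr (hat α) upper j i → Tr (hat α) upper j′ i′ → ¬ j < j′
  hat-tr-unique p p′ j<j′ with hat-tr upper p | hat-tr upper p′
  ... | _ , z , z∈ , lo , refl | _ , z′ , z′∈ , lo′ , refl with Leftover.last lo z′∈
  ...   | inj₁ refl = Finₚ.<-irrefl refl j<j′
  ...   | inj₂ z′≺z = Finₚ.<-asym j<j′ (z′≺z upper)

  hat-linked : ∀ {a b} → Linked α a b → Linked (hat α) a b
  hat-linked = gmap (λ x → x) λ { (s , p) → s , arc-hat s p }

  -- Hatting creates no transversals and removes no arcs, so the required connections persist.
  hat-through : Through α → Through (hat α)
  hat-through H p = hat-linked (H (proj₁ (hat-tr upper p)))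

  hat-total : Total α → Total (hat α)
  hat-total tot (inj₁ a) with hat-view upper a
  ... | plain _ eq = _ , trans eq (proj₂ (tot (inj₁ a)))
  ... | first xy refl = _ , hat-first upper xy
  ... | second xy refl = _ , hat-second upper xy
  ... | final _ _ _ eq = _ , trans eq (proj₂ (tot (inj₁ a)))
  hat-total tot (inj₂ a) with hat-view lower a
  ... | plain _ eq = _ , trans eq (proj₂ (tot (inj₂ a)))
  ... | first xy refl = _ , hat-first lower xy
  ... | second xy refl = _ , hat-second lower xy
  ... | final _ _ _ eq = _ , trans eq (proj₂ (tot (inj₂ a)))

  rank≤1 : (∀ {j i j′ i′} → Tr α upper j i → Tr α upper j′ i′ → ¬ j < j′) → rank α ≡ 0 ⊎ rank α ≡ 1
  rank≤1 h = go (transversals α) transversals-sorted λ x∈ y∈ → h (at-tr upper x∈) (at-tr upper y∈)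
    where
    go : ∀ xs → AllPairs _≺_ xs → (∀ {x y} → x ∈ xs → y ∈ xs → ¬ proj₁ x < proj₁ y) →
      length xs ≡ 0 ⊎ length xs ≡ 1
    go [] _ _ = inj₁ refl
    go (_ ∷ []) _ _ = inj₂ refl
    go (_ ∷ _ ∷ _) ((r ∷ _) ∷ _) h′ = ⊥-elim (h′ (here refl) (there (here refl)) (r upper))

rank0⇒noTr : ∀ {n} {α : Diag n} → rank α ≡ 0 → ∀ {j i} → ¬ Tr α upper j i
rank0⇒noTr {α = α} eq p with transversals α | ∈-transversals⁺ α p
... | _ ∷ _ | _ with () ← eq

rank1⇒unique : ∀ {n} {α : Diag n} → rank α ≡ 1 → ∀ {j i j′ i′} → Tr α upper j i → Tr α upper j′ i′ → j ≡ j′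
rank1⇒unique {α = α} eq p p′ with transversals α | ∈-transversals⁺ α p | ∈-transversals⁺ α p′
... | _ ∷ [] | here refl | here refl = refl

-- Both monoids at once, and the image of the hat map

record Admissible {n} (S : Kind) (α : Diag n) : Set where
  field
    noncrossing : Noncrossing α
    ordered : OrderedTr α
    total : S ≡ Jones → Total α

inS⇒admissible : ∀ {n} S {α : Diag n} → InS S α → Admissible S α
inS⇒admissible Motzkin {α} (m , p) = record
  { noncrossing = planar⇒noncrossing α m p ; ordered = planar⇒orderedTr α m p ; total = λ () }
inS⇒admissible Jones {α} (m , p , t) = record
  { noncrossing = planar⇒noncrossing α m p ; ordered = planar⇒orderedTr α m p ; total = λ _ → t }

admissible⇒inS : ∀ {n} S {α : Diag n} → Admissible S α → InS S α
admissible⇒inS Motzkin {α} r = noncrossing⇒matching α noncrossing , noncrossing⇒planar α noncrossing ordered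
  where open Admissible r
admissible⇒inS Jones {α} r = noncrossing⇒matching α noncrossing , noncrossing⇒planar α noncrossing ordered , total refl
  where open Admissible r

hat-inD : ∀ {n} S (α : Diag n) → InE S α → InD S (hat α)
hat-inD S α (αS , idem) = conclude (rank≤1 (hat-noncrossing noncrossing ordered)
    (hat-orderedTr noncrossing ordered) (hat-tr-unique noncrossing ordered))
  where
  open Admissible (inS⇒admissible S αS)
  hatS : InS S (hat α)
  hatS = admissible⇒inS S record
    { noncrossing = hat-noncrossing noncrossing ordered
    ; ordered = hat-orderedTr noncrossing ordered
    ; total = hat-total noncrossing ordered ∘ total }
  conclude : rank (hat α) ≡ 0 ⊎ rank (hat α) ≡ 1 → InD S (hat α)
  conclude (inj₁ r0) = inj₁ (hatS , r0)
  conclude (inj₂ r1) = inj₂ ((hatS , through⇒idempotent (hat-noncrossing noncrossing ordered)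
    (hat-through noncrossing ordered (idempotent⇒through noncrossing idem))) , r1)

-- Selections of return arcs

lookup-ext : ∀ {A : Set} {n} {xs ys : Vec A n} → (∀ i → lookup xs i ≡ lookup ys i) → xs ≡ ys
lookup-ext {xs = xs} {ys} h = trans (sym (Vecₚ.tabulate∘lookup xs)) (trans (Vecₚ.tabulate-cong h) (Vecₚ.tabulate∘lookup ys))

partner-ext : ∀ {n} {α β : Diag n} → (∀ s a → partner α (vtx s a) ≡ partner β (vtx s a)) → α ≡ β
partner-ext h = cong₂ mkDiag (lookup-ext (h upper)) (lookup-ext (h lower))

at-ext : ∀ {n} {x y : Fin n × Fin n} → (∀ s → at s x ≡ at s y) → x ≡ y
at-ext h = cong₂ _,_ (h upper) (h lower)

module _ {n : ℕ} (δ : Diag n) where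

  rep : Fin n → Fin n
  rep a with least (comp δ a)
  ... | inj₁ (v , _) = v
  -- The default never occurs, because `comp δ a` contains `a`.
  ... | inj₂ _ = a

  rep-linked : ∀ a → Linked δ a (rep a)
  rep-linked a with least (comp δ a)
  ... | inj₁ (v , h , _) = comp-sound δ a h
  ... | inj₂ none = ε

  rep-least : ∀ a {w} → Linked δ a w → ¬ w < rep a
  rep-least a a~w with least (comp δ a)
  ... | inj₁ (_ , _ , h) = h _ (comp-complete δ a a~w)
  ... | inj₂ none = ⊥-elim (true≢false (comp-complete δ a a~w) (none _))

  isRep-least : ∀ {v w} → isRep δ v ≡ true → Linked δ v w → ¬ w < v
  isRep-least {v} {w} h v~w w<v with ∨-true {not (comp δ v w)} (all-allFin _ h w)
  ... | inj₁ e = true≢false (comp-complete δ v v~w) (not-true e)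
  ... | inj₂ e = true≢false (<⇒<ᶠ w<v) (not-true e)

  least-isRep : ∀ {v} → (∀ {w} → Linked δ v w → ¬ w < v) → isRep δ v ≡ true
  least-isRep {v} h = allFin-all _ λ w → go w
    where
    go : ∀ w → (not (comp δ v w) ∨ not (w <ᶠ v)) ≡ true
    go w with comp δ v w in eq
    ... | false = refl
    ... | true = false⇒not (≮⇒<ᶠ (h (comp-sound δ v eq)))

  other : Side → Fin n → Fin n
  -- The default is harmless: `Selected` demands the arc itself in its field `arcs`.
  other s a = fromMaybe a (nb δ s a)

  mate : Fin n × Fin n → Fin n × Fin n
  mate (j , i) = other upper j , other lower i

  other-arc : ∀ s {a b} → Arc δ s a b → other s a ≡ b
  other-arc s p rewrite arc⇒nb δ s p = refl

  at-mate : ∀ s x → at s (mate x) ≡ other s (at s x)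
  at-mate upper x = refl
  at-mate lower x = refl

  record Return (s : Side) (a b : Fin n) : Set where
    field
      outermost : ∀ {c e} → Arc δ s c e → c < a → ¬ b < e
      leftmost : ∀ {x y} → Tr δ s x y → ¬ x < a

  record Selected (v : Fin n) (x : Fin n × Fin n) : Set where
    field
      is-rep : isRep δ v ≡ true
      cycle : ∀ {w} → Linked δ v w → ∀ s → ∃ λ w′ → Arc δ s w w′
      linked : ∀ s → Linked δ v (at s x)
      ascends : ∀ s → at s x < at s (mate x)
      arcs : ∀ s → Arc δ s (at s x) (at s (mate x))
      returns : ∀ s → Return s (at s x) (at s (mate x))

    linked-mate : ∀ s → Linked δ v (at s (mate x))
    linked-mate s = linked s ◅◅ (s , arcs s) ◅ ε

  -- c v = just (j , i): in the cycle with least vertex v, the return arcs starting at j and at i′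
  -- are selected, to be replaced by two transversals joining their left and their right ends.
  Selection : Set
  Selection = Fin n → Maybe (Fin n × Fin n)

  Valid : Selection → Set
  Valid c = ∀ {v x} → c v ≡ just x → Selected v x

  cut : Side → Fin n → Maybe (Fin n × Fin n) → Maybe (V n)
  cut s a nothing = partner δ (vtx s a)
  cut s a (just x) =
    if a == at s x then just (vtxᵒ s (at (opp s) x))
    else (if a == at s (mate x) then just (vtxᵒ s (at (opp s) (mate x))) else partner δ (vtx s a))

  -- Choices are stored at the least vertices of components, to which the factors of `f` belong; a
  -- vertex `a` therefore looks up the choice for its cycle at `rep a`.
  build : Selection → Diag n
  build c = mkDiag (Vec.tabulate (λ a → cut upper a (c (rep a)))) (Vec.tabulate (λ a → cut lower a (c (rep a))))

  build-cut : ∀ c s a → partner (build c) (vtx s a) ≡ cut s a (c (rep a))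
  build-cut c upper a = lookup∘tabulate _ a
  build-cut c lower a = lookup∘tabulate _ a

-- Cutting the selected arcs

module _ {n : ℕ} {δ : Diag n} (nc : Noncrossing δ) where
  open Noncrossing nc

  rep-isRep : ∀ a → isRep δ (rep δ a) ≡ true
  rep-isRep a = least-isRep δ λ l → rep-least δ a (rep-linked δ a ◅◅ l)

  isRep-unique : ∀ {v a} → isRep δ v ≡ true → Linked δ v a → rep δ a ≡ v
  isRep-unique {v} {a} h v~a with Finₚ.<-cmp (rep δ a) v
  ... | tri≈ _ eq _ = eq
  ... | tri< lt _ _ = ⊥-elim (isRep-least δ h (v~a ◅◅ rep-linked δ a) lt)
  ... | tri> _ _ gt = ⊥-elim (rep-least δ a (linked-sym v~a) gt)

  module _ {c : Selection δ} (valid : Valid δ c) where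

    private
      β : Diag n
      β = build δ c

    module _ {v : Fin n} {x : Fin n × Fin n} (sel : c v ≡ just x) where
      open Selected (valid sel)

      sel-rep : ∀ {a} → Linked δ v a → c (rep δ a) ≡ just x
      sel-rep l = trans (cong c (isRep-unique is-rep l)) sel

      build-first : ∀ s → Tr β s (at s x) (at (opp s) x)
      build-first s rewrite build-cut δ c s (at s x) | sel-rep (linked s) | ==-refl (at s x) = refl

      build-second : ∀ s → Tr β s (at s (mate δ x)) (at (opp s) (mate δ x))
      build-second s rewrite build-cut δ c s (at s (mate δ x)) | sel-rep (linked-mate s)
        | ≢⇒== {i = at s (mate δ x)} {at s x} (λ eq → Finₚ.<-irrefl (sym eq) (ascends s))
        | ==-refl (at s (mate δ x)) = refl

    Unselected : Side → Fin n → Set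
    Unselected s a = ∀ {v x} → c v ≡ just x → a ≢ at s x × a ≢ at s (mate δ x)

    data BuildView (s : Side) (a : Fin n) : Set where
      first : ∀ {v x} → c v ≡ just x → a ≡ at s x → BuildView s a
      second : ∀ {v x} → c v ≡ just x → a ≡ at s (mate δ x) → BuildView s a
      plain : Unselected s a → partner β (vtx s a) ≡ partner δ (vtx s a) → BuildView s a

    build-view : ∀ s a → BuildView s a
    build-view s a with c (rep δ a) in eq
    ... | nothing = plain
          (λ sel → let open Selected (valid sel) in
            (λ { refl → clash sel (linked s) }) , (λ { refl → clash sel (linked-mate s) }))
          (trans (build-cut δ c s a) (cong (cut δ s a) eq))
      where
      clash : ∀ {v x} → c v ≡ just x → Linked δ v a → ⊥
      clash sel l with () ← trans (sym eq) (sel-rep sel l)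
    ... | just x with a ≟ᶠ at s x | a ≟ᶠ at s (mate δ x)
    ...   | yes a≡ | _ = first eq a≡
    ...   | no _ | yes a≡ = second eq a≡
    ...   | no a≢ | no a≢′ = plain
            (λ sel → let open Selected (valid sel) in
              (λ { refl → a≢ (cong (at s) (same sel (linked s))) })
              , (λ { refl → a≢′ (cong (at s ∘ mate δ) (same sel (linked-mate s))) }))
            (trans (build-cut δ c s a) (trans (cong (cut δ s a) eq) cut-plain))
      where
      same : ∀ {v x′} → c v ≡ just x′ → Linked δ v a → x′ ≡ x
      same sel l = just-injective (trans (sym (sel-rep sel l)) eq)
      cut-plain : cut δ s a (just x) ≡ partner δ (vtx s a)
      cut-plain rewrite ≢⇒== a≢ | ≢⇒== a≢′ = refl

    build-arc : ∀ s {a b} → Arc β s a b → Arc δ s a b × Unselected s a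
    build-arc s {a} p with build-view s a
    ... | first sel refl = ⊥-elim (tr⇒noArc {α = β} s (build-first sel s) p)
    ... | second sel refl = ⊥-elim (tr⇒noArc {α = β} s (build-second sel s) p)
    ... | plain un eq = trans (sym eq) p , un

    plain-build : ∀ s {a} → Unselected s a → partner β (vtx s a) ≡ partner δ (vtx s a)
    plain-build s {a} un with build-view s a
    ... | first sel a≡ = ⊥-elim (proj₁ (un sel) a≡)
    ... | second sel a≡ = ⊥-elim (proj₂ (un sel) a≡)
    ... | plain _ eq = eq

    arc-build : ∀ s {a b} → Unselected s a → Arc δ s a b → Arc β s a b
    arc-build s un p = trans (plain-build s un) p

    arc-unselected : ∀ s {a b} → Unselected s a → Arc δ s a b → Unselected s b
    arc-unselected s un p sel = let open Selected (valid sel) in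
      (λ { refl → proj₂ (un sel) (arc-fun {α = δ} s (arc-sym s p) (arcs s)) }) ,
      (λ { refl → proj₁ (un sel) (arc-fun {α = δ} s (arc-sym s p) (arc-sym s (arcs s))) })

    tr-unselected : ∀ s {a b} → Tr δ s a b → Unselected s a
    tr-unselected s p sel = let open Selected (valid sel) in
      (λ { refl → tr⇒noArc {α = δ} s p (arcs s) }) , (λ { refl → tr⇒noArc {α = δ} s p (arc-sym s (arcs s)) })

    data BuildTr (s : Side) (a b : Fin n) : Set where
      first : ∀ {v x} → c v ≡ just x → a ≡ at s x → b ≡ at (opp s) x → BuildTr s a b
      second : ∀ {v x} → c v ≡ just x → a ≡ at s (mate δ x) → b ≡ at (opp s) (mate δ x) → BuildTr s a b
      plain : Tr δ s a b → BuildTr s a b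

    build-tr : ∀ s {a b} → Tr β s a b → BuildTr s a b
    build-tr s {a} p with build-view s a
    ... | first sel refl = first sel refl (tr-fun {α = β} s p (build-first sel s))
    ... | second sel refl = second sel refl (tr-fun {α = β} s p (build-second sel s))
    ... | plain un eq = plain (trans (sym eq) p)

    tr-uncovered : ∀ s {a b x y} → Tr β s x y → Arc δ s a b → a < x → ¬ x < b
    tr-uncovered s {a} {b} p q a<x x<b with build-tr s p
    ... | plain p′ = no-cover s q p′ a<x x<b
    ... | first {x = z} sel refl refl with Finₚ.<-cmp b (at s (mate δ z))
    ...   | tri< lt _ _ = no-cross s q (Selected.arcs (valid sel) s) a<x x<b lt
    ...   | tri≈ _ refl _ = Finₚ.<-irrefl
              (arc-fun {α = δ} s (arc-sym s q) (arc-sym s (Selected.arcs (valid sel) s))) a<x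
    ...   | tri> _ _ gt = Return.outermost (Selected.returns (valid sel) s) q a<x gt
    tr-uncovered s {a} {b} p q a<x x<b | second {x = z} sel refl refl with Finₚ.<-cmp a (at s z)
    ...   | tri> _ _ gt = no-cross s (Selected.arcs (valid sel) s) q gt a<x x<b
    ...   | tri≈ _ refl _ = Finₚ.<-irrefl (arc-fun {α = δ} s (Selected.arcs (valid sel) s) q) x<b
    ...   | tri< lt _ _ = Return.outermost (Selected.returns (valid sel) s) q lt x<b

    build-noncrossing : Noncrossing β
    build-noncrossing = record
      { arc-sym = λ s p → let q , un = build-arc s p in arc-build s (arc-unselected s un q) (arc-sym s q)
      ; arc-irr = λ s p → arc-irr s (proj₁ (build-arc s p))
      ; tr-sym = build-tr-sym
      ; no-cross = λ s p q → no-cross s (proj₁ (build-arc s p)) (proj₁ (build-arc s q))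
      ; no-cover = λ s p q → tr-uncovered s q (proj₁ (build-arc s p))
      }
      where
      build-tr-sym : ∀ s {a b} → Tr β s a b → Tr β (opp s) b a
      build-tr-sym s p with build-tr s p
      build-tr-sym upper p | first sel refl refl = build-first sel lower
      build-tr-sym lower p | first sel refl refl = build-first sel upper
      build-tr-sym upper p | second sel refl refl = build-second sel lower
      build-tr-sym lower p | second sel refl refl = build-second sel upper
      build-tr-sym upper p | plain q = trans (plain-build lower (tr-unselected lower (tr-sym upper q))) (tr-sym upper q)
      build-tr-sym lower p | plain q = trans (plain-build upper (tr-unselected upper (tr-sym lower q))) (tr-sym lower q)

    open Noncrossing build-noncrossing using () renaming (linked-sym to linkedβ-sym; arc-sym to arcβ-sym; arc-irr to arcβ-irr)

    linked-build⇒ : ∀ {a b} → Linked β a b → Linked δ a b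
    linked-build⇒ = gmap (λ x → x) λ { (s , p) → s , proj₁ (build-arc s p) }

    same-selection : ∀ {v x v′ x′ a} → c v ≡ just x → c v′ ≡ just x′ → Linked δ v a → Linked δ v′ a → x ≡ x′
    same-selection sel sel′ l l′ = just-injective (trans (sym (sel-rep sel l)) (sel-rep sel′ l′))

    -- If the path left at an end of the cut upper arc met no end of the cut lower arc, lower arcs
    -- would match its vertices; their number being even, the path would then also contain the other
    -- end of the upper arc, hence be the whole cycle, including the ends of the lower arc.
    module _ {v : Fin n} {x : Fin n × Fin n} (sel : c v ≡ just x) (p p̄ : Fin n × Fin n)
      (v~p : ∀ s → Linked δ v (at s p)) (bare : NoArc β upper (at upper p)) (pp̄ : ∀ s → Arc δ s (at s p) (at s p̄))
      (covers : ∀ s {w} → w ≡ at s x ⊎ w ≡ at s (mate δ x) → w ≡ at s p ⊎ w ≡ at s p̄) where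

      private
        C : Fin n → Bool
        C = comp β (at upper p)

        C⊆ : ∀ {w} → C w ≡ true → Linked δ v w
        C⊆ Cw = v~p upper ◅◅ linked-build⇒ (comp-sound β (at upper p) Cw)

        -- Every vertex of the cycle has an arc of δ on side `s`, which survives unless it is the
        -- cut one.
        arc-or-end : ∀ s {w} → C w ≡ true → (∃ λ w′ → Arc β s w w′ × C w′ ≡ true) ⊎ (w ≡ at s p ⊎ w ≡ at s p̄)
        arc-or-end s {w} Cw with build-view s w
        ... | plain un _ = let w′ , q = Selected.cycle (valid sel) (C⊆ Cw) s ; q′ = arc-build s un q in
              inj₁ (w′ , q′ , comp-closed β (at upper p) Cw (s , q′))
        ... | first sel′ refl with same-selection sel sel′ (C⊆ Cw) (Selected.linked (valid sel′) s)
        ...   | eq = inj₂ (covers s (inj₁ (cong (at s) (sym eq))))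
        arc-or-end s {w} Cw | second sel′ refl with same-selection sel sel′ (C⊆ Cw) (Selected.linked-mate (valid sel′) s)
        ...   | eq = inj₂ (covers s (inj₂ (cong (at s ∘ mate δ) (sym eq))))

        swap-ends : ∀ s {w w′} → w ≡ at s p ⊎ w ≡ at s p̄ → Arc δ s w w′ → w′ ≡ at s p ⊎ w′ ≡ at s p̄
        swap-ends s (inj₁ refl) q = inj₂ (arc-fun {α = δ} s q (pp̄ s))
        swap-ends s (inj₂ refl) q = inj₁ (arc-fun {α = δ} s q (arc-sym s (pp̄ s)))

        matched : ∀ s (D : Fin n → Bool) → (∀ w → D w ≡ true → ∃ λ w′ → Arc β s w w′ × D w′ ≡ true) → parity D ≡ false
        matched s = parity-matched {M = Arc β s} (arcβ-sym s) (arcβ-irr s) (arc-fun {α = β} s)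

        start∈ : C (at upper p) ≡ true
        start∈ = comp-complete β (at upper p) ε

        module _ (p∉ : C (at lower p) ≡ false) (p̄∉ : C (at lower p̄) ≡ false) where

          lower-arc : ∀ w → C w ≡ true → ∃ λ w′ → Arc β lower w w′ × C w′ ≡ true
          lower-arc w Cw with arc-or-end lower Cw
          ... | inj₁ h = h
          ... | inj₂ (inj₁ refl) = ⊥-elim (true≢false Cw p∉)
          ... | inj₂ (inj₂ refl) = ⊥-elim (true≢false Cw p̄∉)

          p̄∈ : C (at upper p̄) ≡ true
          p̄∈ with C (at upper p̄) in eq
          ... | true = refl
          -- The upper arcs would match all of `C` but its start, the lower arcs all of `C`: its
          -- size would be odd and even.
          ... | false = ⊥-elim (true≢false
                (trans (parity-∖ {C = C} (at upper p) start∈) (cong not (matched upper (C ∖ at upper p) upper-arc)))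
                (matched lower C lower-arc))
            where
            upper-arc : ∀ w → (C ∖ at upper p) w ≡ true → ∃ λ w′ → Arc β upper w w′ × (C ∖ at upper p) w′ ≡ true
            upper-arc w h with ∈-∖ {C = C} h
            ... | Cw , w≢ with arc-or-end upper Cw
            ...   | inj₁ (w′ , q , Cw′) = w′ , q , ∖-∈ {C = C} Cw′ λ { refl → bare (arcβ-sym upper q) }
            ...   | inj₂ (inj₁ w≡) = ⊥-elim (w≢ w≡)
            ...   | inj₂ (inj₂ refl) = ⊥-elim (true≢false Cw eq)

          -- Of the arcs of δ at vertices of `C`, only the two cut ones can be missing in β; the
          -- upper one has both ends in `C`, the lower one neither.
          C-closed : Closed δ C
          C-closed {w} {w′} Cw (s , q) with arc-or-end s Cw
          ... | inj₁ (w″ , q′ , Cw″) = subst (λ z → C z ≡ true) (arc-fun {α = δ} s (proj₁ (build-arc s q′)) q) Cw″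
          C-closed {w} {w′} Cw (upper , q) | inj₂ e with swap-ends upper e q
          ... | inj₁ refl = start∈
          ... | inj₂ refl = p̄∈
          C-closed {w} {w′} Cw (lower , q) | inj₂ (inj₁ refl) = ⊥-elim (true≢false Cw p∉)
          C-closed {w} {w′} Cw (lower , q) | inj₂ (inj₂ refl) = ⊥-elim (true≢false Cw p̄∉)

          absurd : ⊥
          absurd = true≢false (closed-linked δ {C = C} C-closed start∈
            (linked-sym (v~p upper) ◅◅ v~p lower)) p∉

      cut-path : Linked β (at upper p) (at lower p) ⊎ Linked β (at upper p) (at lower p̄)
      cut-path with C (at lower p) in eq | C (at lower p̄) in eq′
      ... | true | _ = inj₁ (comp-sound β (at upper p) eq)
      ... | false | true = inj₂ (comp-sound β (at upper p) eq′)
      ... | false | false = ⊥-elim (absurd eq eq′)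

    module _ {v : Fin n} {x : Fin n × Fin n} (sel : c v ≡ just x) where
      open Selected (valid sel)

      private
        x′ = mate δ x

        firstX : ∀ s → Exposed build-noncrossing s (at s x)
        firstX s = tr-exposed build-noncrossing s (build-first sel s)
        secondX : ∀ s → Exposed build-noncrossing s (at s x′)
        secondX s = tr-exposed build-noncrossing s (build-second sel s)

        strand : ∀ {j i} → Exposed build-noncrossing upper j → Exposed build-noncrossing lower i →
          Linked β j i → Strand build-noncrossing (ends j i)
        strand X Y l = record { exposed = λ { upper → X ; lower → Y } ; joined = l }

        not-joined : ∀ {i} → Exposed build-noncrossing lower i →
          Linked β (at upper x) i → Linked β (at upper x′) i → ⊥
        not-joined X l l′ = Finₚ.<-irrefl
          (sym (Strand.strand-end (strand (firstX upper) X l) upper (l ◅◅ linkedβ-sym l′) (Exposed.bare (secondX upper))))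
          (ascends upper)

      -- Of the four combinations of paths, two would give a strand two upper ends, and the one that
      -- joins left ends to right ends would reverse the order of two strands.
      cut-through : Linked β (at upper x) (at lower x) × Linked β (at upper x′) (at lower x′)
      cut-through with
          cut-path sel x x′ linked (Exposed.bare (firstX upper)) arcs (λ _ h → h)
        | cut-path sel x′ x linked-mate (Exposed.bare (secondX upper)) (λ s → arc-sym s (arcs s)) (λ _ → swap)
      ... | inj₁ l | inj₁ l′ = l , l′
      ... | inj₁ l | inj₂ l′ = ⊥-elim (not-joined (firstX lower) l l′)
      ... | inj₂ l | inj₁ l′ = ⊥-elim (not-joined (secondX lower) l l′)
      ... | inj₂ l | inj₂ l′ = ⊥-elim (Finₚ.<-asym (ascends lower)
            (strands-ordered build-noncrossing (strand (firstX upper) (secondX lower) l)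
              (strand (secondX upper) (firstX lower) l′) (ascends upper)))

    build-through : Through δ → Through β
    build-through H {j} p with build-tr upper p
    ... | first sel refl refl = proj₁ (cut-through sel)
    ... | second sel refl refl = proj₂ (cut-through sel)
    -- The component of an old transversal is not a cycle, as `j` has no upper arc; so none of its
    -- arcs is cut.
    ... | plain q = keep ε (H q)
      where
      off-cycles : ∀ {w} → Linked δ j w → ∀ s → Unselected s w
      off-cycles l s sel = let open Selected (valid sel) in
        (λ { refl → clash sel (linked s ◅◅ linked-sym l) }) , (λ { refl → clash sel (linked-mate s ◅◅ linked-sym l) })
        where
        clash : ∀ {v x} → c v ≡ just x → Linked δ v j → ⊥
        clash sel l′ = tr⇒noArc {α = δ} upper q (proj₂ (Selected.cycle (valid sel) l′ upper))
      keep : ∀ {a b} → Linked δ j a → Linked δ a b → Linked β a b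
      keep l ε = ε
      keep l ((s , e) ◅ es) = (s , arc-build s (off-cycles l s) e) ◅ keep (l ◅◅ (s , e) ◅ ε) es

    build-orderedTr : Through δ → OrderedTr β
    build-orderedTr H p q = strands-ordered build-noncrossing
      (tr-strand build-noncrossing p (build-through H p)) (tr-strand build-noncrossing q (build-through H q))

    build-total : Total δ → Total β
    build-total tot (inj₁ a) with build-view upper a
    ... | first sel refl = _ , build-first sel upper
    ... | second sel refl = _ , build-second sel upper
    ... | plain _ eq = _ , trans eq (proj₂ (tot (inj₁ a)))
    build-total tot (inj₂ a) with build-view lower a
    ... | first sel refl = _ , build-first sel lower
    ... | second sel refl = _ , build-second sel lower
    ... | plain _ eq = _ , trans eq (proj₂ (tot (inj₂ a)))

-- The first element is not maximal, so it has a mate, and a mate beyond the second element would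
-- have this one in between. Hence the first two are mates, and by uniqueness the mates of all
-- others lie in the rest of the list.
pairUp-mates : ∀ {A : Set} {R M : A → A → Set} → (∀ {x} → ¬ R x x) → (∀ {x y} → M x y → M y x) →
  (∀ {x} → ¬ M x x) → (∀ {x y z} → M x y → M x z → y ≡ z) → ∀ {xs} → AllPairs R xs →
  (∀ {x} → x ∈ xs → (∃ λ y → y ∈ xs × M x y × (∀ {z} → z ∈ xs → R x z → ¬ R z y)) ⊎ (∀ {z} → z ∈ xs → ¬ R x z)) →
  ∀ {x y} → (x , y) ∈ pairUp xs → M x y
pairUp-mates {A} {R} {M} R-irr M-sym M-irr M-fun = go
  where
  go : ∀ {xs} → AllPairs R xs →
    (∀ {x} → x ∈ xs → (∃ λ y → y ∈ xs × M x y × (∀ {z} → z ∈ xs → R x z → ¬ R z y)) ⊎ (∀ {z} → z ∈ xs → ¬ R x z)) →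
    ∀ {x y} → (x , y) ∈ pairUp xs → M x y
  go {a ∷ b ∷ r} ((ab ∷ as) ∷ bs ∷ ap) h = λ { (here refl) → Mab ; (there xy) → go ap tail xy }
    where
    Mab : M a b
    Mab with h (here refl)
    ... | inj₂ max = ⊥-elim (max (there (here refl)) ab)
    ... | inj₁ (_ , here refl , m , _) = ⊥-elim (M-irr m)
    ... | inj₁ (_ , there (here refl) , m , _) = m
    ... | inj₁ (y , there (there y∈) , m , gap) = ⊥-elim (gap (there (here refl)) ab (All.lookup bs y∈))
    tail : ∀ {x} → x ∈ r → (∃ λ y → y ∈ r × M x y × (∀ {z} → z ∈ r → R x z → ¬ R z y)) ⊎ (∀ {z} → z ∈ r → ¬ R x z)
    tail x∈ with h (there (there x∈))
    ... | inj₂ max = inj₂ λ z∈ → max (there (there z∈))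
    ... | inj₁ (_ , here refl , m , _) with refl ← M-fun (M-sym m) Mab = ⊥-elim (R-irr (All.lookup bs x∈))
    ... | inj₁ (_ , there (here refl) , m , _) with refl ← M-fun (M-sym m) (M-sym Mab) = ⊥-elim (R-irr (All.lookup as x∈))
    ... | inj₁ (y , there (there y∈) , m , gap) = inj₁ (y , y∈ , m , λ z∈ → gap (there (there z∈)))

-- Hatting undoes cutting

TrUnique : ∀ {n} → Diag n → Set
TrUnique δ = ∀ {j i j′ i′} → Tr δ upper j i → Tr δ upper j′ i′ → j ≡ j′

module _ {n : ℕ} {δ : Diag n} (nc : Noncrossing δ) where
  open Noncrossing nc

  private
    Mates : Fin n × Fin n → Fin n × Fin n → Set
    Mates x y = ∀ s → Arc δ s (at s x) (at s y)

    mates-sym : ∀ {x y} → Mates x y → Mates y x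
    mates-sym m s = arc-sym s (m s)

    mates-fun : ∀ {x y z} → Mates x y → Mates x z → y ≡ z
    mates-fun m m′ = at-ext λ s → arc-fun {α = δ} s (m s) (m′ s)

  module _ {c : Selection δ} (valid : Valid δ c) (H : Through δ) (unique : TrUnique δ) where

    private
      β : Diag n
      β = build δ c

      ncβ : Noncrossing β
      ncβ = build-noncrossing nc valid

      ordβ : OrderedTr β
      ordβ = build-orderedTr nc valid H

      ts : List (Fin n × Fin n)
      ts = transversals β

      first∈ : ∀ {v x} → c v ≡ just x → x ∈ ts
      first∈ sel = ∈-transversals⁺ β (build-first nc valid sel upper)

      second∈ : ∀ {v x} → c v ≡ just x → mate δ x ∈ ts
      second∈ sel = ∈-transversals⁺ β (build-second nc valid sel upper)

      -- A return arc does not start to the right of the transversal of δ and does not cover it, so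
      -- it also ends to its left. The old transversal thus comes last and stays unpaired.
      rightmost : ∀ {j i z} → Tr δ upper j i → z ∈ ts → ¬ j < at upper z
      rightmost {j} p z∈ lt with build-tr nc valid upper (∈-transversals⁻ β z∈)
      ... | plain q = Finₚ.<-irrefl (unique p q) lt
      ... | first sel refl _ = Return.leftmost (Selected.returns (valid sel) upper) p lt
      ... | second {x = x} sel refl _ with Finₚ.<-cmp j (at upper x)
      ...   | tri< lt′ _ _ = Return.leftmost (Selected.returns (valid sel) upper) p lt′
      ...   | tri≈ _ refl _ = tr⇒noArc {α = δ} upper p (Selected.arcs (valid sel) upper)
      ...   | tri> _ _ gt = no-cover upper (Selected.arcs (valid sel) upper) p gt lt

      gap : ∀ {x y z} → Mates x y → z ∈ ts → x ≺ z → ¬ z ≺ y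
      gap m z∈ x≺z z≺y = tr-uncovered nc valid upper (∈-transversals⁻ β z∈) (m upper) (x≺z upper) (z≺y upper)

      mated : ∀ {z} → z ∈ ts → (∃ λ y → y ∈ ts × Mates z y) ⊎ Tr δ upper (at upper z) (at lower z)
      mated z∈ with build-tr nc valid upper (∈-transversals⁻ β z∈)
      ... | plain q = inj₂ q
      ... | first sel refl refl = inj₁ (_ , second∈ sel , Selected.arcs (valid sel))
      ... | second sel refl refl = inj₁ (_ , first∈ sel , mates-sym (Selected.arcs (valid sel)))

      pairs-mates : ∀ {x y} → Pair ncβ ordβ x y → Mates x y
      pairs-mates = pairUp-mates {R = _≺_} {Mates} (λ x≺x → Finₚ.<-irrefl refl (x≺x upper)) mates-sym
        (λ m → arc-irr upper (m upper)) mates-fun (transversals-sorted ncβ ordβ) λ z∈ → locate (mated z∈)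
        where
        locate : ∀ {z} → (∃ λ y → y ∈ ts × Mates z y) ⊎ Tr δ upper (at upper z) (at lower z) →
          (∃ λ y → y ∈ ts × Mates z y × (∀ {w} → w ∈ ts → z ≺ w → ¬ w ≺ y)) ⊎ (∀ {w} → w ∈ ts → ¬ z ≺ w)
        locate (inj₁ (y , y∈ , m)) = inj₁ (y , y∈ , m , gap m)
        locate (inj₂ p) = inj₂ λ w∈ z≺w → rightmost p w∈ (z≺w upper)

      -- If the mate `y` is in a pair, its partner there is its own mate `z`, which however comes
      -- after all pairs. If `y` is left over too, both are last and hence equal.
      leftover-unmated : ∀ {z y} → z ∈ ts → Leftover {R = _≺_} ts z → y ∈ ts → ¬ Mates z y
      leftover-unmated z∈ lo y∈ m with pairUp-view (transversals-sorted ncβ ordβ) y∈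
      ... | first yw with refl ← mates-fun (mates-sym m) (pairs-mates yw) =
            Finₚ.<-irrefl refl (proj₂ (Leftover.after-pairs lo yw) upper)
      ... | second wy with refl ← mates-fun (mates-sym m) (mates-sym (pairs-mates wy)) =
            Finₚ.<-irrefl refl (proj₁ (Leftover.after-pairs lo wy) upper)
      ... | leftover lo′ with Leftover.last lo y∈ | Leftover.last lo′ z∈
      ...   | inj₁ refl | _ = arc-irr upper (m upper)
      ...   | _ | inj₁ refl = arc-irr upper (m upper)
      ...   | inj₂ y≺z | inj₂ z≺y = Finₚ.<-asym (y≺z upper) (z≺y upper)

    hat-build : hat β ≡ δ
    hat-build = partner-ext agree
      where
      agree : ∀ s a → partner (hat β) (vtx s a) ≡ partner δ (vtx s a)
      agree s a with hat-view ncβ ordβ s a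
      ... | first xy refl = trans (hat-first ncβ ordβ s xy) (sym (pairs-mates xy s))
      ... | second xy refl = trans (hat-second ncβ ordβ s xy) (sym (mates-sym (pairs-mates xy) s))
      ... | plain noTr eq with build-view nc valid s a
      ...   | plain _ eq′ = trans eq eq′
      ...   | first sel refl = ⊥-elim (noTr (build-first nc valid sel s))
      ...   | second sel refl = ⊥-elim (noTr (build-second nc valid sel s))
      agree s a | final z∈ lo refl eq with mated z∈
      ...   | inj₁ (y , y∈ , m) = ⊥-elim (leftover-unmated z∈ lo y∈ m)
      agree upper a | final z∈ lo refl eq | inj₂ p = trans eq (trans (at-tr ncβ ordβ upper z∈) (sym p))
      agree lower a | final z∈ lo refl eq | inj₂ p = trans eq (trans (at-tr ncβ ordβ lower z∈) (sym (tr-sym upper p)))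

  -- The transversal at `at upper x` betrays the choice. In `build δ c′` it cannot be old, as δ has
  -- an arc there, nor sit at the right end of a cut arc, as this arc ascends. Its lower end then
  -- gives the rest of `x`, and the component gives `v`.
  selection-⊆ : ∀ {c c′ : Selection δ} → Valid δ c → Valid δ c′ → build δ c ≡ build δ c′ →
    ∀ {v x} → c v ≡ just x → c′ v ≡ just x
  selection-⊆ {c} {c′} valid valid′ eq {v} {x} sel with build-view nc valid′ upper (at upper x)
  ... | plain _ eq′ = ⊥-elim (tr⇒noArc {α = δ} upper
          (trans (sym eq′) (subst (λ β → Tr β upper (at upper x) (at lower x)) eq (build-first nc valid sel upper)))
          (Selected.arcs (valid sel) upper))
  ... | second {x = x′} sel′ a≡ = ⊥-elim (Finₚ.<-asym (Selected.ascends (valid′ sel′) upper)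
          (subst₂ _<_ a≡ (arc-fun {α = δ} upper
            (Selected.arcs (valid sel) upper)
            (subst (λ a → Arc δ upper a (at upper x′)) (sym a≡) (arc-sym upper (Selected.arcs (valid′ sel′) upper))))
            (Selected.ascends (valid sel) upper)))
  ... | first {v′} {x′} sel′ a≡ = trans (cong c′ v≡v′) (trans sel′ (cong just (sym (at-ext same))))
    where
    build-tr′ : Tr (build δ c′) upper (at upper x) (at lower x)
    build-tr′ = subst (λ β → Tr β upper (at upper x) (at lower x)) eq (build-first nc valid sel upper)
    same : ∀ s → at s x ≡ at s x′
    same upper = a≡
    same lower = tr-fun {α = build δ c′} upper build-tr′
      (subst (λ a → Tr (build δ c′) upper a (at lower x′)) (sym a≡) (build-first nc valid′ sel′ upper))
    v≡v′ : v ≡ v′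
    v≡v′ = trans (sym (isRep-unique nc (Selected.is-rep (valid sel)) (Selected.linked (valid sel) upper)))
      (trans (cong (rep δ) a≡) (isRep-unique nc (Selected.is-rep (valid′ sel′)) (Selected.linked (valid′ sel′) upper)))

  build-injective : ∀ {c c′ : Selection δ} → Valid δ c → Valid δ c′ → build δ c ≡ build δ c′ → ∀ v → c v ≡ c′ v
  build-injective {c} {c′} valid valid′ eq v with c v in e | c′ v in e′
  ... | just x | _ = trans (sym (selection-⊆ valid valid′ eq e)) e′
  ... | nothing | nothing = refl
  ... | nothing | just x′ = trans (sym e) (selection-⊆ valid′ valid (sym eq) e′)

-- The selection belonging to an idempotent

module _ {n : ℕ} {α : Diag n} (nc : Noncrossing α) (ord : OrderedTr α) (H : Through α) where
  open Noncrossing nc using (linked-sym)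

  private
    δ : Diag n
    δ = hat α

    ncδ : Noncrossing δ
    ncδ = hat-noncrossing nc ord

    pairs : List ((Fin n × Fin n) × (Fin n × Fin n))
    pairs = pairUp (transversals α)

    firstIn : Fin n → List ((Fin n × Fin n) × (Fin n × Fin n)) → Maybe (Fin n × Fin n)
    firstIn v [] = nothing
    firstIn v ((x , y) ∷ ps) = if comp δ v (at upper x) then just x else firstIn v ps

    firstIn-sound : ∀ v ps {x} → firstIn v ps ≡ just x → Linked δ v (at upper x) × ∃ λ y → (x , y) ∈ ps
    firstIn-sound v ((x , y) ∷ ps) eq with comp δ v (at upper x) in h
    firstIn-sound v ((x , y) ∷ ps) refl | true = comp-sound δ v h , y , here refl
    ... | false = let l , y , xy = firstIn-sound v ps eq in l , y , there xy

    firstIn-complete : ∀ v ps {x y} → (x , y) ∈ ps → Linked δ v (at upper x) → ∃ λ x′ → firstIn v ps ≡ just x′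
    firstIn-complete v ((x , y) ∷ ps) xy l with comp δ v (at upper x) in h
    ... | true = x , refl
    firstIn-complete v ((x , y) ∷ ps) (here refl) l | false = ⊥-elim (true≢false (comp-complete δ v l) h)
    firstIn-complete v ((x , y) ∷ ps) (there xy) l | false = firstIn-complete v ps xy l

  -- By `pair-unique` a cycle contains at most one pair of former transversals, so taking the first
  -- one found is no real choice.
  selection : Selection δ
  selection v = if isRep δ v then firstIn v pairs else nothing

  private
    selection-sound : ∀ {v x} → selection v ≡ just x →
      isRep δ v ≡ true × Linked δ v (at upper x) × ∃ λ y → Pair nc ord x y
    selection-sound {v} eq with isRep δ v
    ... | true = refl , firstIn-sound v pairs eq

    pair-mate : ∀ {x y} → Pair nc ord x y → mate δ x ≡ y
    pair-mate {x} xy = at-ext λ s → trans (at-mate δ s x) (other-arc δ s (hat-first nc ord s xy))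

    at-through : ∀ {x} → x ∈ transversals α → ∀ s → Linked α (at upper x) (at s x)
    at-through x∈ upper = ε
    at-through x∈ lower = H (∈-transversals⁻ α x∈)

    strand-∈ : ∀ {x} → x ∈ transversals α → Strand nc (ends (at upper x) (at lower x))
    strand-∈ x∈ = tr-strand nc (∈-transversals⁻ α x∈) (H (∈-transversals⁻ α x∈))

    strand-bare : ∀ {x} → x ∈ transversals α → ∀ s {w} → Linked α (at upper x) w → NoArc α s w → w ≡ at s x
    strand-bare x∈ upper = Strand.strand-end (strand-∈ x∈) upper
    strand-bare x∈ lower = Strand.strand-end (strand-∈ x∈) lower

    -- A strand vertex has its old arc on side `s` or is the end of the strand there, from which the
    -- hat arc leads to the other strand. So the two strands together form a cycle.
    strand-arc : ∀ {x y} → x ∈ transversals α → y ∈ transversals α → (∀ s → Arc δ s (at s x) (at s y)) →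
      ∀ s {w} → Linked α (at upper x) w → ∃ λ w′ → Arc δ s w w′ × (Linked α (at upper x) w′ ⊎ Linked α (at upper y) w′)
    strand-arc x∈ y∈ xy s {w} l with arc? α s w
    ... | inj₁ (w′ , q) = w′ , arc-hat nc ord s q , inj₁ (l ◅◅ (s , q) ◅ ε)
    ... | inj₂ none with refl ← strand-bare x∈ s l none = _ , xy s , inj₂ (at-through y∈ s)

    module _ {x y : Fin n × Fin n} (xy : Pair nc ord x y) where

      x∈ : x ∈ transversals α
      x∈ = proj₁ (pair-∈ nc ord xy)
      y∈ : y ∈ transversals α
      y∈ = proj₂ (pair-∈ nc ord xy)

      OnPair : Fin n → Set
      OnPair w = Linked α (at upper x) w ⊎ Linked α (at upper y) w

      pair-arc : ∀ s {w} → OnPair w → ∃ λ w′ → Arc δ s w w′ × OnPair w′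
      pair-arc s (inj₁ l) = strand-arc x∈ y∈ (λ s → hat-first nc ord s xy) s l
      pair-arc s (inj₂ l) =
        let w′ , q , r = strand-arc y∈ x∈ (λ s → hat-second nc ord s xy) s l in w′ , q , swap r

      pair-linked : ∀ {w w′} → OnPair w → Linked δ w w′ → OnPair w′
      pair-linked o ε = o
      pair-linked o ((s , p) ◅ l) with pair-arc s o
      ... | w′ , q , o′ with refl ← arc-fun {α = δ} s p q = pair-linked o′ l

      -- An enclosing arc would cover the former transversal at `at s x`, against `hat-cover`; a
      -- transversal still present is the leftover one, to the right of all pairs.
      pair-return : ∀ s → Return δ s (at s x) (at s y)
      pair-return s = record
        { outermost = λ p c<x y<e → hat-cover nc ord s p (at-tr nc ord s x∈) c<x (Finₚ.<-trans (pair-≺ nc ord xy s) y<e)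
        ; leftmost = λ p t<x → let _ , z , _ , lo , t≡ = hat-tr nc ord s p in
            Finₚ.<-asym (subst (_< at s x) t≡ t<x) (proj₁ (Leftover.after-pairs lo xy) s) }

      -- The cycle consists of the strands of `x` and `y`, so its only vertices without an upper arc
      -- in α are their upper ends. Thus `x′` has the upper end of `x` or of `y`, and the latter
      -- would reverse a pair.
      pair-unique : ∀ {x′ y′} → Pair nc ord x′ y′ → Linked δ (at upper x) (at upper x′) → x′ ≡ x
      pair-unique x′y′ l with pair-linked (inj₁ ε) l
      ... | inj₁ l′ = at-ext λ { upper → same ; lower → tr-fun {α = α} upper
              (at-tr nc ord upper x′∈) (subst (λ a → Tr α upper a (at lower x)) (sym same) (at-tr nc ord upper x∈)) }
        where
        x′∈ = proj₁ (pair-∈ nc ord x′y′)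
        same = strand-bare x∈ upper l′ (tr⇒noArc {α = α} upper (at-tr nc ord upper x′∈))
      ... | inj₂ l′ = ⊥-elim (Finₚ.<-asym (pair-≺ nc ord x′y′ upper)
              (subst₂ _<_ (arc-fun {α = δ} upper (hat-second nc ord upper xy)
                  (subst (λ a → Arc δ upper a _) same (hat-first nc ord upper x′y′)))
                (sym same) (pair-≺ nc ord xy upper)))
        where
        same = strand-bare y∈ upper l′ (tr⇒noArc {α = α} upper (at-tr nc ord upper (proj₁ (pair-∈ nc ord x′y′))))

  selection-valid : Valid δ selection
  selection-valid {v} {x} sel with selection-sound sel
  ... | is-rep , l , y , xy with refl ← pair-mate xy = record
    { is-rep = is-rep
    ; cycle = λ v~w s → let w′ , p , _ = pair-arc xy s (pair-linked xy (inj₁ ε) (Noncrossing.linked-sym ncδ l ◅◅ v~w)) in w′ , p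
    ; linked = λ s → l ◅◅ hat-linked nc ord (at-through (x∈ xy) s)
    ; ascends = pair-≺ nc ord xy
    ; arcs = λ s → hat-first nc ord s xy
    ; returns = pair-return xy
    }

  private
    selection-complete : ∀ {x y a} → Pair nc ord x y → Linked δ a (at upper x) → selection (rep δ a) ≡ just x
    selection-complete {x} {y} {a} xy l rewrite rep-isRep ncδ a
      with firstIn-complete (rep δ a) pairs xy (Noncrossing.linked-sym ncδ (rep-linked δ a) ◅◅ l)
    ... | x′ , eq with firstIn-sound (rep δ a) pairs eq
    ...   | l′ , y′ , x′y′ = trans eq (cong just (pair-unique xy x′y′
            (Noncrossing.linked-sym ncδ l ◅◅ rep-linked δ a ◅◅ l′)))

  build-selection : build δ selection ≡ α
  build-selection = partner-ext agree
    where
    agree : ∀ s a → partner (build δ selection) (vtx s a) ≡ partner α (vtx s a)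
    agree s a with build-view ncδ selection-valid s a
    ... | first sel refl with selection-sound sel
    ...   | _ , _ , y , xy = trans (build-first ncδ selection-valid sel s) (sym (at-tr nc ord s (x∈ xy)))
    agree s a | second sel refl with selection-sound sel
    ...   | _ , _ , y , xy with refl ← pair-mate xy =
            trans (build-second ncδ selection-valid sel s) (sym (at-tr nc ord s (y∈ xy)))
    agree s a | plain un eq with hat-view nc ord s a
    ...   | plain _ eq′ = trans eq eq′
    ...   | final _ _ _ eq′ = trans eq eq′
    ...   | first xy refl = ⊥-elim (proj₁ (un (selection-complete xy
              (hat-linked nc ord (linked-sym (at-through (x∈ xy) s))))) refl)
    ...   | second {x = x} xy refl = ⊥-elim (proj₂ (un (selection-complete xy
              ((s , hat-second nc ord s xy) ◅ hat-linked nc ord (linked-sym (at-through (x∈ xy) s)))))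
              (cong (at s) (sym (pair-mate xy))))

-- The Boolean tests of f

∧-false : ∀ {a b} → a ∧ b ≡ false → a ≡ false ⊎ b ≡ false
∧-false {false} _ = inj₁ refl
∧-false {true} eq = inj₂ eq

not-false : ∀ {b} → not b ≡ false → b ≡ true
not-false {true} _ = refl

≢false⇒≡true : ∀ {b} → ¬ b ≡ false → b ≡ true
≢false⇒≡true = ¬-not

any-false : ∀ {n} {p : Fin n → Bool} → any p (allFin n) ≡ false → ∀ x → p x ≡ false
any-false {p = p} h x = ≢true⇒≡false λ px → true≢false (allFin-any p x px) h

module _ {n : ℕ} (δ : Diag n) where

  transUp-tr : ∀ {x} → transUp δ x ≡ true → ∃ λ y → Tr δ upper x y
  transUp-tr {x} h with lookup (up δ) x
  ... | just (inj₂ y) = y , refl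

  tr-transUp : ∀ {x y} → Tr δ upper x y → transUp δ x ≡ true
  tr-transUp {x} p with lookup (up δ) x
  tr-transUp {x} refl | just (inj₂ y) = refl

  transLow-tr : ∀ {x} → transLow δ x ≡ true → ∃ λ y → Tr δ lower x y
  transLow-tr {x} h with lookup (low δ) x
  ... | just (inj₁ y) = y , refl

  tr-transLow : ∀ {x y} → Tr δ lower x y → transLow δ x ≡ true
  tr-transLow {x} p with lookup (low δ) x
  tr-transLow {x} refl | just (inj₁ y) = refl

  isReturn : Side → Fin n → Fin n → Bool
  isReturn upper = upRet δ
  isReturn lower = lowRet δ

  isReturn-sound : ∀ s {a b} → isReturn s a b ≡ true → Return δ s a b
  isReturn-sound upper {a} {b} h = record { outermost = outermost ; leftmost = leftmost }
    where
    outermost : ∀ {c e} → Arc δ upper c e → c < a → ¬ b < e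
    outermost {c} p c<a b<e
      with upNb δ c | arc⇒nb δ upper p | any-false (not-true (proj₁ (∧-true h))) c
    ... | just _ | refl | nested = true≢false (true-∧ (<⇒<ᶠ c<a) (<⇒<ᶠ b<e)) nested
    leftmost : ∀ {x y} → Tr δ upper x y → ¬ x < a
    leftmost {x} p x<a = true≢false (true-∧ (<⇒<ᶠ x<a) (tr-transUp p)) (any-false (not-true (proj₂ (∧-true h))) x)
  isReturn-sound lower {a} {b} h = record { outermost = outermost ; leftmost = leftmost }
    where
    outermost : ∀ {c e} → Arc δ lower c e → c < a → ¬ b < e
    outermost {c} p c<a b<e
      with lowNb δ c | arc⇒nb δ lower p | any-false (not-true (proj₁ (∧-true h))) c
    ... | just _ | refl | nested = true≢false (true-∧ (<⇒<ᶠ c<a) (<⇒<ᶠ b<e)) nested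
    leftmost : ∀ {x y} → Tr δ lower x y → ¬ x < a
    leftmost {x} p x<a = true≢false (true-∧ (<⇒<ᶠ x<a) (tr-transLow p)) (any-false (not-true (proj₂ (∧-true h))) x)

  isReturn-complete : ∀ s {a b} → Return δ s a b → isReturn s a b ≡ true
  isReturn-complete s {a} {b} r = ≢false⇒≡true (refute s r)
    where
    refute : ∀ s → Return δ s a b → ¬ isReturn s a b ≡ false
    refute upper r h with ∧-false h
    ... | inj₂ h′ with any-allFin _ (not-false h′)
    ...   | x , hx with ∧-true {x <ᶠ a} hx
    ...     | x<a , t = Return.leftmost r (proj₂ (transUp-tr t)) (<ᶠ⇒< x<a)
    refute upper r h | inj₁ h′ with any-allFin _ (not-false h′)
    ...   | c , hc with upNb δ c in eq
    ...     | just e with ∧-true {c <ᶠ a} hc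
    ...       | c<a , b<e = Return.outermost r (nb⇒arc δ upper eq) (<ᶠ⇒< c<a) (<ᶠ⇒< b<e)
    refute lower r h with ∧-false h
    ... | inj₂ h′ with any-allFin _ (not-false h′)
    ...   | x , hx with ∧-true {x <ᶠ a} hx
    ...     | x<a , t = Return.leftmost r (proj₂ (transLow-tr t)) (<ᶠ⇒< x<a)
    refute lower r h | inj₁ h′ with any-allFin _ (not-false h′)
    ...   | c , hc with lowNb δ c in eq
    ...     | just e with ∧-true {c <ᶠ a} hc
    ...       | c<a , b<e = Return.outermost r (nb⇒arc δ lower eq) (<ᶠ⇒< c<a) (<ᶠ⇒< b<e)

  -- Only the left end of an arc is marked, so that each return arc is counted once.
  startsReturn : Side → Fin n → Bool
  startsReturn s a = maybe (λ b → (a <ᶠ b) ∧ isReturn s a b) false (nb δ s a)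

  returnStarts : Side → (Fin n → Bool) → List (Fin n)
  returnStarts s C = mapMaybe (λ a → if C a ∧ startsReturn s a then just a else nothing) (allFin n)

  module _ (C : Fin n → Bool) where

    -- The test counted by uCount is a local definition of uCount; unification recovers it.
    uTest : Σ (Fin n → Bool) λ ok → uCount δ C ≡ countB (λ a → C a ∧ ok a)
    uTest = _ , refl

    lTest : Σ (Fin n → Bool) λ ok → lCount δ C ≡ countB (λ a → C a ∧ ok a)
    lTest = _ , refl

    uTest-starts : ∀ a → proj₁ uTest a ≡ startsReturn upper a
    uTest-starts a with upNb δ a
    ... | just b = refl
    ... | nothing = refl

    lTest-starts : ∀ a → proj₁ lTest a ≡ startsReturn lower a
    lTest-starts a with lowNb δ a
    ... | just b = refl
    ... | nothing = refl

    uCount-length : uCount δ C ≡ length (returnStarts upper C)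
    uCount-length = cong length (mapMaybe-cong
      (λ a → cong (λ b → if C a ∧ b then just a else nothing) (uTest-starts a)) (allFin n))

    lCount-length : lCount δ C ≡ length (returnStarts lower C)
    lCount-length = cong length (mapMaybe-cong
      (λ a → cong (λ b → if C a ∧ b then just a else nothing) (lTest-starts a)) (allFin n))

  if-just : ∀ {a a′ : Fin n} {b} → (if b then just a else nothing) ≡ just a′ → b ≡ true × a ≡ a′
  if-just {b = true} refl = refl , refl

  ∈-returnStarts⁻ : ∀ s {C a} → a ∈ returnStarts s C →
    C a ≡ true × Arc δ s a (other δ s a) × a < other δ s a × Return δ s a (other δ s a)
  ∈-returnStarts⁻ s {C} {a} a∈ with ∈-mapMaybe⁻ (allFin n) a∈
  ... | a′ , _ , eq with if-just {a′} eq
  ...   | h , refl with ∧-true {C a} h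
  ...     | Ca , st with nb δ s a in e
  ...       | just b with ∧-true {a <ᶠ b} st
  ...         | lt , r = Ca , nb⇒arc δ s e , <ᶠ⇒< lt , isReturn-sound s r

  ∈-returnStarts⁺ : ∀ s {C a b} → C a ≡ true → Arc δ s a b → a < b → Return δ s a b → a ∈ returnStarts s C
  ∈-returnStarts⁺ s {C} {a} {b} Ca p a<b r = ∈-mapMaybe⁺ (∈-allFin a) chosen
    where
    chosen : (if C a ∧ startsReturn s a then just a else nothing) ≡ just a
    chosen rewrite Ca | arc⇒nb δ s p | <⇒<ᶠ a<b | isReturn-complete s r = refl

  returnStarts-unique : ∀ s C → Unique (returnStarts s C)
  returnStarts-unique s C = mapMaybe-allPairs
    (λ a≢a′ eq eq′ b≡b′ → a≢a′ (trans (proj₂ (if-just eq)) (trans b≡b′ (sym (proj₂ (if-just eq′))))))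
    (Unique.allFin⁺ n)

  isCycle-sound : ∀ {v} → isCycle δ (comp δ v) ≡ true → ∀ {w} → Linked δ v w → ∀ s → ∃ λ w′ → Arc δ s w w′
  isCycle-sound {v} h {w} l s with all-allFin _ h w
  ... | t rewrite comp-complete δ v l with ∧-true {is-just (upNb δ w)} t
  isCycle-sound {v} h {w} l upper | t | hu , hl with upNb δ w in eq
  ... | just w′ = w′ , nb⇒arc δ upper eq
  isCycle-sound {v} h {w} l lower | t | hu , hl with lowNb δ w in eq
  ... | just w′ = w′ , nb⇒arc δ lower eq

  isCycle-complete : ∀ {v} → (∀ {w} → Linked δ v w → ∀ s → ∃ λ w′ → Arc δ s w w′) → isCycle δ (comp δ v) ≡ true
  isCycle-complete {v} h = allFin-all _ test
    where
    test : ∀ w → not (comp δ v w) ∨ (is-just (upNb δ w) ∧ is-just (lowNb δ w)) ≡ true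
    test w with comp δ v w in eq
    ... | false = refl
    ... | true rewrite arc⇒nb δ upper (proj₂ (h (comp-sound δ v eq) upper))
                     | arc⇒nb δ lower (proj₂ (h (comp-sound δ v eq) lower)) = refl

  candidates : Fin n → List (Fin n × Fin n)
  candidates v = cartesianProduct (returnStarts upper (comp δ v)) (returnStarts lower (comp δ v))

  -- The option `nothing` leaves the cycle uncut, and it is the only one if `v` is not the least
  -- vertex of a cycle; the number of options is the factor of `v` in `f δ`.
  options : Fin n → List (Maybe (Fin n × Fin n))
  options v = nothing ∷ (if isRep δ v ∧ isCycle δ (comp δ v) then map just (candidates v) else [])

  options-sound : ∀ {v x} → just x ∈ options v → Selected δ v x
  options-sound {v} {x} (there x∈) with isRep δ v ∧ isCycle δ (comp δ v) in eq
  ... | true with ∈-map⁻ just x∈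
  ...   | _ , x∈′ , refl with ∈-cartesianProduct⁻ (returnStarts upper (comp δ v)) _ x∈′ | ∧-true {isRep δ v} eq
  ...     | j∈ , i∈ | is-rep , is-cycle with ∈-returnStarts⁻ upper j∈ | ∈-returnStarts⁻ lower i∈
  ...       | Cj , pj , ltj , rj | Ci , pi , lti , ri = record
    { is-rep = is-rep
    ; cycle = isCycle-sound is-cycle
    ; linked = λ { upper → comp-sound δ v Cj ; lower → comp-sound δ v Ci }
    ; ascends = λ { upper → ltj ; lower → lti }
    ; arcs = λ { upper → pj ; lower → pi }
    ; returns = λ { upper → rj ; lower → ri }
    }

  options-complete : ∀ {v x} → Selected δ v x → just x ∈ options v
  options-complete {v} {x} sel rewrite Selected.is-rep sel | isCycle-complete (Selected.cycle sel) =
    there (∈-map⁺ just (∈-cartesianProduct⁺ (starts upper) (starts lower)))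
    where
    open Selected sel
    starts : ∀ s → at s x ∈ returnStarts s (comp δ v)
    starts s = ∈-returnStarts⁺ s (comp-complete δ v (linked s)) (arcs s) (ascends s) (returns s)

  options-unique : ∀ v → Unique (options v)
  options-unique v with isRep δ v ∧ isCycle δ (comp δ v)
  ... | false = [] ∷ []
  ... | true = All.tabulate (λ x∈ eq → absurd (∈-map⁻ just x∈) eq) ∷ Unique.map⁺ just-injective
        (Unique.cartesianProduct⁺ (returnStarts-unique upper (comp δ v)) (returnStarts-unique lower (comp δ v)))
    where
    absurd : ∀ {x} → (∃ λ y → y ∈ candidates v × x ≡ just y) → nothing ≡ x → ⊥
    absurd (_ , _ , refl) ()

-- Counting independent choices

length-cartesianProductWith : ∀ {A B C : Set} (h : A → B → C) xs ys →
  length (cartesianProductWith h xs ys) ≡ length xs ℕ.* length ys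
length-cartesianProductWith h [] ys = refl
length-cartesianProductWith h (x ∷ xs) ys = trans (length-++ (map (h x) ys))
  (cong₂ ℕ._+_ (length-map (h x) ys) (length-cartesianProductWith h xs ys))

module _ {A : Set} where

  -- Choices are vectors rather than functions: a vector is determined by its entries, so distinct
  -- choices are distinct for `≡`.
  choices : ∀ {m} → (Fin m → List A) → List (Vec A m)
  choices {zero} o = [] ∷ []
  choices {suc m} o = cartesianProductWith _∷_ (o Fin.zero) (choices (o ∘ Fin.suc))

  length-choices : ∀ {m} (o : Fin m → List A) → length (choices o) ≡ product (tabulate (length ∘ o))
  length-choices {zero} o = refl
  length-choices {suc m} o = trans (length-cartesianProductWith _∷_ (o Fin.zero) _)
    (cong (length (o Fin.zero) ℕ.*_) (length-choices (o ∘ Fin.suc)))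

  ∈-choices⁺ : ∀ {m} (o : Fin m → List A) (c : Vec A m) → (∀ v → lookup c v ∈ o v) → c ∈ choices o
  ∈-choices⁺ o [] h = here refl
  ∈-choices⁺ o (x ∷ c) h =
    ∈-cartesianProductWith⁺ _∷_ (h Fin.zero) (∈-choices⁺ (o ∘ Fin.suc) c (h ∘ Fin.suc))

  ∈-choices⁻ : ∀ {m} (o : Fin m → List A) {c : Vec A m} → c ∈ choices o → ∀ v → lookup c v ∈ o v
  ∈-choices⁻ {suc m} o c∈ v with ∈-cartesianProductWith⁻ _∷_ (o Fin.zero) (choices (o ∘ Fin.suc)) c∈
  ∈-choices⁻ {suc m} o c∈ Fin.zero | _ , _ , x∈ , _ , refl = x∈
  ∈-choices⁻ {suc m} o c∈ (Fin.suc v) | _ , _ , _ , c′∈ , refl = ∈-choices⁻ (o ∘ Fin.suc) c′∈ v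

  choices-unique : ∀ {m} (o : Fin m → List A) → (∀ v → Unique (o v)) → Unique (choices o)
  choices-unique {zero} o h = [] ∷ []
  choices-unique {suc m} o h =
    Unique.cartesianProductWith⁺ _∷_ Vecₚ.∷-injective (h Fin.zero) (choices-unique (o ∘ Fin.suc) (h ∘ Fin.suc))

module _ {A B : Set} where

  unique-map-∈ : ∀ {h : A → B} {xs} → (∀ {x y} → x ∈ xs → y ∈ xs → h x ≡ h y → x ≡ y) → Unique xs → Unique (map h xs)
  unique-map-∈ inj [] = []
  unique-map-∈ {h} {x ∷ xs} inj (x∉ ∷ u) =
    All.tabulate (λ y∈ eq → let z , z∈ , y≡ = ∈-map⁻ h y∈ in
      All.lookup x∉ z∈ (inj (here refl) (there z∈) (trans eq y≡)))
    ∷ unique-map-∈ (λ y∈ z∈ → inj (there y∈) (there z∈)) u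

  module _ (g : A → List B) where

    length-concatMap : ∀ xs → length (concatMap g xs) ≡ sum (map (length ∘ g) xs)
    length-concatMap [] = refl
    length-concatMap (x ∷ xs) = trans (length-++ (g x)) (cong (length (g x) ℕ.+_) (length-concatMap xs))

    concatMap-unique : ∀ {xs} → (∀ {x} → x ∈ xs → Unique (g x)) →
      (∀ {x x′ y} → x ∈ xs → x′ ∈ xs → y ∈ g x → y ∈ g x′ → x ≡ x′) → Unique xs → Unique (concatMap g xs)
    concatMap-unique {[]} h d [] = []
    concatMap-unique {x ∷ xs} h d (x∉ ∷ u) = Unique.++⁺ (h (here refl))
      (concatMap-unique (h ∘ there) (λ x∈ x′∈ → d (there x∈) (there x′∈)) u)
      λ (y∈ , y∈′) → let x′ , x′∈ , y∈x′ = find (∈-concatMap⁻ g {xs} y∈′) in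
        All.lookup x∉ x′∈ (d (here refl) (there x′∈) y∈ y∈x′)

-- The fibres of the hat map

module _ {n : ℕ} where

  -- For δ in D(S) this lists the set of idempotents with hat δ: `fibre-hat` and `fibre-inE` give
  -- one inclusion, `inE-fibre` the other.
  fibre : Diag n → List (Diag n)
  fibre δ = map (build δ ∘ lookup) (choices (options δ))

  length-fibre : ∀ δ → length (fibre δ) ≡ f δ
  length-fibre δ = trans (length-map _ (choices (options δ))) (trans (length-choices (options δ))
    (sym (cong product (trans (map-tabulate (λ v → v) _) (tabulate-cong factor)))))
    where
    factor : ∀ v → (if isRep δ v ∧ isCycle δ (comp δ v)
      then 1 ℕ.+ uCount δ (comp δ v) ℕ.* lCount δ (comp δ v) else 1) ≡ length (options δ v)
    factor v with isRep δ v ∧ isCycle δ (comp δ v)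
    ... | false = refl
    ... | true = cong suc (trans (cong₂ ℕ._*_ (uCount-length δ (comp δ v)) (lCount-length δ (comp δ v)))
          (sym (trans (length-map just (candidates δ v)) (length-cartesianProductWith _,_
            (returnStarts δ upper (comp δ v)) (returnStarts δ lower (comp δ v))))))

  choice-valid : ∀ {δ : Diag n} {c} → c ∈ choices (options δ) → Valid δ (lookup c)
  choice-valid {δ} c∈ {v} eq = options-sound δ (subst (_∈ options δ v) eq (∈-choices⁻ (options δ) c∈ v))

  inD⇒inS : ∀ S {δ : Diag n} → InD S δ → InS S δ
  inD⇒inS S (inj₁ (δS , _)) = δS
  inD⇒inS S (inj₂ ((δS , _) , _)) = δS

  inD⇒through : ∀ S {δ : Diag n} → InD S δ → Through δ
  inD⇒through S {δ} (inj₁ (_ , r0)) p = ⊥-elim (rank0⇒noTr {α = δ} r0 p)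
  inD⇒through S (inj₂ ((δS , idem) , _)) = idempotent⇒through (Admissible.noncrossing (inS⇒admissible S δS)) idem

  inD⇒unique : ∀ S {δ : Diag n} → InD S δ → TrUnique δ
  inD⇒unique S {δ} (inj₁ (_ , r0)) p = ⊥-elim (rank0⇒noTr {α = δ} r0 p)
  inD⇒unique S {δ} (inj₂ (_ , r1)) = rank1⇒unique {α = δ} r1

  module _ (S : Kind) {δ : Diag n} (δD : InD S δ) where
    open Admissible (inS⇒admissible S (inD⇒inS S δD))

    fibre-hat : ∀ {α} → α ∈ fibre δ → hat α ≡ δ
    fibre-hat α∈ with ∈-map⁻ (build δ ∘ lookup) α∈
    ... | c , c∈ , refl = hat-build noncrossing (choice-valid c∈) (inD⇒through S δD) (inD⇒unique S δD)

    fibre-inE : ∀ {α} → α ∈ fibre δ → InE S α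
    fibre-inE α∈ with ∈-map⁻ (build δ ∘ lookup) α∈
    ... | c , c∈ , refl = admissible⇒inS S record
            { noncrossing = ncβ
            ; ordered = build-orderedTr noncrossing valid (inD⇒through S δD)
            ; total = build-total noncrossing valid ∘ total }
          , through⇒idempotent ncβ (build-through noncrossing valid (inD⇒through S δD))
      where
      valid = choice-valid {δ} c∈
      ncβ = build-noncrossing noncrossing valid

    fibre-unique : Unique (fibre δ)
    fibre-unique = unique-map-∈
      (λ c∈ c′∈ eq → lookup-ext (build-injective noncrossing (choice-valid c∈) (choice-valid c′∈) eq))
      (choices-unique (options δ) (options-unique δ))

  inE-fibre : ∀ S {α : Diag n} → InE S α → α ∈ fibre (hat α)
  inE-fibre S {α} (αS , idem) = subst (_∈ fibre δ) built (∈-map⁺ (build δ ∘ lookup) (∈-choices⁺ (options δ) c c∈))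
    where
    open Admissible (inS⇒admissible S αS)
    δ = hat α
    H = idempotent⇒through noncrossing idem
    sel = selection noncrossing ordered H
    c = Vec.tabulate sel
    c∈ : ∀ v → lookup c v ∈ options δ v
    c∈ v rewrite lookup∘tabulate sel v with sel v in eq
    ... | nothing = here refl
    ... | just x = options-complete δ (selection-valid noncrossing ordered H eq)
    built : build δ (lookup c) ≡ α
    built = trans (build-cong λ v → lookup∘tabulate sel v) (build-selection noncrossing ordered H)
      where
      build-cong : ∀ {c c′ : Selection δ} → (∀ v → c v ≡ c′ v) → build δ c ≡ build δ c′
      build-cong {c} {c′} h = partner-ext λ s a →
        trans (build-cut δ c s a) (trans (cong (cut δ s a) (h (rep δ a))) (sym (build-cut δ c′ s a)))

theorem3p6 : (S : Kind) (n : ℕ) → 1 ≤ n →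
    ((α : Diag n) → InE S α → InD S (hat α)) ×
    ((es ds : List (Diag n)) →
    Unique es → ((α : Diag n) → (α ∈ es) ⇔ InE S α) →
    Unique ds → ((δ : Diag n) → (δ ∈ ds) ⇔ InD S δ) →
    length es ≡ sum (map f ds))
theorem3p6 S n _ = hat-inD S , count
  where
  count : (es ds : List (Diag n)) →
    Unique es → ((α : Diag n) → (α ∈ es) ⇔ InE S α) →
    Unique ds → ((δ : Diag n) → (δ ∈ ds) ⇔ InD S δ) →
    length es ≡ sum (map f ds)
  -- Duplicate-free lists with the same members are permutations of each other, so `es` can be
  -- exchanged for the concatenated fibres.
  count es ds es! es⇔ ds! ds⇔ = trans
    (↭-length (∼bag⇒↭ (unique∧set⇒bag es! all! λ {α} → mk⇔ (to α) (from α))))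
    (trans (length-concatMap fibre ds) (cong sum (map-cong length-fibre ds)))
    where
    inD : ∀ {δ} → δ ∈ ds → InD S δ
    inD = Equivalence.to (ds⇔ _)
    all! : Unique (concatMap fibre ds)
    all! = concatMap-unique fibre (λ δ∈ → fibre-unique S (inD δ∈))
      -- Fibres over different diagrams are disjoint, since `hat` recovers the base point.
      (λ δ∈ δ′∈ α∈ α∈′ → trans (sym (fibre-hat S (inD δ∈) α∈)) (fibre-hat S (inD δ′∈) α∈′)) ds!
    to : ∀ α → α ∈ es → α ∈ concatMap fibre ds
    to α α∈ = let αE = Equivalence.to (es⇔ α) α∈ in
      ∈-concatMap⁺ fibre (lose (Equivalence.from (ds⇔ (hat α)) (hat-inD S α αE)) (inE-fibre S αE))
    from : ∀ α → α ∈ concatMap fibre ds → α ∈ es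
    from α α∈ = let δ , δ∈ , α∈δ = find (∈-concatMap⁻ fibre {ds} α∈) in
      Equivalence.from (es⇔ α) (fibre-inE S (inD δ∈) α∈δ)
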